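{- Let $n$ be a positive integer and let $q \equiv 1 \pmod n$ be a prime power. Let $\chi_n \in \widehat{\mathbb{F}_q^{*}}$ be a character of order $n$. Let $A_1, \dots, A_m, B_1, \dots, B_m \in \widehat{\mathbb{F}_q^{*}}$. If $\lambda \in \mathbb{F}_q$ is not an $n$-th power in $\mathbb{F}_q$, then $${}_{nm}F_{nm}\left( \begin{array}{c} A_i \chi_n^l : 1 \leq i \leq m,\ 0 \leq l \leq n-1 \\ B_i \chi_n^l : 1 \leq i \leq m,\ 0 \leq l \leq n-1 \end{array} \Big| \; \lambda \right)_{q}=0.$$
   Context: $\mathbb{F}_q$ is the finite field with $q$ elements and $\widehat{\mathbb{F}_q^*}$ the group of (complex) multiplicative characters of $\mathbb{F}_q^*$; every $\chi\in\widehat{\mathbb{F}_q^*}$, including the trivial character $\varepsilon$, is extended to $\mathbb{F}_q$ by $\chi(0):=0$, and $\overline{\chi}$ denotes the inverse of $\chi$. Fix a non-trivial additive character $\theta$ of $\mathbb{F}_q$ and define the Gauss sum $g(\chi):=\sum_{x\in\mathbb{F}_q}\chi(x)\theta(x)$. For $A_1,\dots,A_m,B_1,\dots,B_m\in\widehat{\mathbb{F}_q^*}$ and $\lambda\in\mathbb{F}_q$, the finite field hypergeometric function is $${}_{m}F_{m}\left( \begin{array}{cccc} A_1, & A_2, & \dots, & A_m \\ B_1, & B_2, & \dots, & B_m \end{array} \Big| \; \lambda \right)_{q} := \frac{ -1}{q-1} \sum_{\chi \in \widehat{\mathbb{F}_q^{*}}} \prod_{i=1}^{m} \frac{g(A_i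 \chi)}{g(A_i)} \frac{g(\overline{B_i \chi})}{g(\overline{B_i})}\, \chi(-1)^{m} \chi(\lambda).$$ -}

module Defs where

open import Level using (0ℓ; _⊔_)
open import Algebra.Apartness.Bundles using (HeytingCommutativeRing; HeytingField)
open import Algebra.Apartness.Structures using (IsHeytingField)
open import Algebra.Bundles using (AbelianGroup; CommutativeRing; Monoid; Semiring)
open import Algebra.Definitions using (Invertible)
open import Algebra.Morphism.Structures using (IsMonoidHomomorphism)
open import Algebra.Structures using (IsCommutativeRing)
open import Data.Fin.Base using (Fin; zero; suc; toℕ; remQuot)
open import Data.Fin.Permutation using (permutation)
open import Data.Fin.Properties as Fin using (suc-injective; pigeonhole; any?)
open import Data.Nat.Base as ℕ using (ℕ; zero; suc; NonZero; _∸_)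
import Data.Nat.Properties as ℕ
open import Data.Product.Base using (∃; _,_; proj₁; proj₂) renaming (_×_ to _∧_)
open import Data.Rational.Base as ℚ using (ℚ; 0ℚ; 1ℚ; ½; ∣_∣)
import Data.Rational.Properties as ℚ
open import Data.Rational.Solver using (module +-*-Solver)
open import Data.Sum.Base as Sum using (_⊎_; inj₁; inj₂; [_,_]′)
open import Function.Base using (_∘_; id)
open import Function.Bundles using (Inverse)
open import Relation.Binary.Bundles using (Setoid)
open import Relation.Binary.PropositionalEquality as ≡ using (_≡_)
import Relation.Binary.Reasoning.Setoid as ≈-Reasoning
open import Relation.Binary.Structures using (IsEquivalence; IsApartnessRelation)
open import Relation.Nullary using (Dec; ¬_; yes; no; contradiction)
open import Relation.Nullary.Decidable using (map′; toSum)

Eventually : (ℕ → Set) → Set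
Eventually P = ∃ λ N → ∀ n → N ℕ.≤ n → P n

-- Cauchy sequences of rationals. Equality is equality of limits (not of
-- sequences), and apartness is a positive eventual lower bound on the distance.
-- Eta is off so that the conversion checker does not compare real
-- numbers by unfolding them to their rational approximations.
record ℝ : Set where
  no-eta-equality
  field
    seq    : ℕ → ℚ
    cauchy : ∀ {ε} → 0ℚ ℚ.< ε →
             ∃ λ N → ∀ m n → N ℕ.≤ m → N ℕ.≤ n → ∣ seq m ℚ.- seq n ∣ ℚ.< ε

open ℝ public

infix 4 _≈ʳ_ _#ʳ_
record _≈ʳ_ (x y : ℝ) : Set where
  constructor mk≈
  field close : ∀ {ε} → 0ℚ ℚ.< ε → Eventually λ n → ∣ seq x n ℚ.- seq y n ∣ ℚ.< ε

record _#ʳ_ (x y : ℝ) : Set where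
  constructor mk#
  field
    gap     : ℚ
    gap>0   : 0ℚ ℚ.< gap
    distant : Eventually λ n → gap ℚ.≤ ∣ seq x n ℚ.- seq y n ∣

open _≈ʳ_
open _#ʳ_

module RationalLemmas where
  open +-*-Solver

  minus-cancel : ∀ p q → (p ℚ.- q) ℚ.+ q ≡ p
  minus-cancel = solve 2 (λ p q → (p :- q) :+ q := p) ≡.refl

  minus-flip : ∀ p q → q ℚ.- p ≡ ℚ.- p ℚ.- ℚ.- q
  minus-flip = solve 2 (λ p q → q :- p := :- p :- :- q) ≡.refl

  minus-shiftʳ : ∀ p q r → p ℚ.- q ≡ (p ℚ.+ r) ℚ.- (q ℚ.+ r)
  minus-shiftʳ = solve 3 (λ a c b → a :- c := (a :+ b) :- (c :+ b)) ≡.refl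

  minus-shiftˡ : ∀ p q r → q ℚ.- r ≡ (p ℚ.+ q) ℚ.- (p ℚ.+ r)
  minus-shiftˡ = solve 3 (λ c b d → b :- d := (c :+ b) :- (c :+ d)) ≡.refl

  factorˡ : ∀ a b c → a ℚ.* (b ℚ.- c) ≡ a ℚ.* b ℚ.- a ℚ.* c
  factorˡ = solve 3 (λ a b c → a :* (b :- c) := a :* b :- a :* c) ≡.refl

  factorʳ : ∀ a b c → c ℚ.* (a ℚ.- b) ≡ a ℚ.* c ℚ.- b ℚ.* c
  factorʳ = solve 3 (λ a b c → c :* (a :- b) := a :* c :- b :* c) ≡.refl

  neg-square : ∀ p → ℚ.- p ℚ.* ℚ.- p ≡ p ℚ.* p
  neg-square = solve 1 (λ p → :- p :* :- p := p :* p) ≡.refl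

  cross : ∀ a b c e → a ℚ.* (c ℚ.* b) ℚ.- (e ℚ.* a) ℚ.* b ≡ (a ℚ.* b) ℚ.* (c ℚ.- e)
  cross = solve 4 (λ a b c e → a :* (c :* b) :- (e :* a) :* b := (a :* b) :* (c :- e)) ≡.refl

  insert-ones : ∀ a b → a ℚ.- b ≡ a ℚ.* 1ℚ ℚ.- 1ℚ ℚ.* b
  insert-ones a b = ≡.sym (≡.cong₂ ℚ._-_ (ℚ.*-identityʳ a) (ℚ.*-identityˡ b))

  shuffle : ∀ d a b t → d ℚ.* (d ℚ.* ((a ℚ.* b) ℚ.* t)) ≡ (d ℚ.* a) ℚ.* ((d ℚ.* b) ℚ.* t)
  shuffle = solve 4 (λ d a b t → d :* (d :* ((a :* b) :* t)) := (d :* a) :* ((d :* b) :* t)) ≡.refl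

  half>0 : ∀ {ε} → 0ℚ ℚ.< ε → 0ℚ ℚ.< ½ ℚ.* ε
  half>0 {ε} ε>0 = ≡.subst (ℚ._< ½ ℚ.* ε) (ℚ.*-zeroʳ ½) (ℚ.*-monoʳ-<-pos ½ ε>0)

  half+half : ∀ ε → ½ ℚ.* ε ℚ.+ ½ ℚ.* ε ≡ ε
  half+half ε = ≡.trans (≡.sym (ℚ.*-distribʳ-+ ε ½ ½)) (ℚ.*-identityˡ ε)

  divide : ∀ {M ε} → 0ℚ ℚ.< M → 0ℚ ℚ.< ε → ∃ λ δ → 0ℚ ℚ.< δ ∧ M ℚ.* δ ≡ ε
  divide {M} {ε} M>0 ε>0 = (ℚ.1/ M) ℚ.* ε ,
    ≡.subst (ℚ._< (ℚ.1/ M) ℚ.* ε) (ℚ.*-zeroʳ (ℚ.1/ M))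
      (ℚ.*-monoʳ-<-pos (ℚ.1/ M) {{1/M-pos}} ε>0) ,
    ≡.trans (≡.sym (ℚ.*-assoc M (ℚ.1/ M) ε))
      (≡.trans (≡.cong (ℚ._* ε) (ℚ.*-inverseʳ M)) (ℚ.*-identityˡ ε))
    where instance
      M-pos : ℚ.Positive M
      M-pos = ℚ.positive M>0
      M-nonZero : ℚ.NonZero M
      M-nonZero = ℚ.pos⇒nonZero M
      1/M-pos : ℚ.Positive (ℚ.1/ M)
      1/M-pos = ℚ.1/pos⇒pos M

  triangle : ∀ p q r → ∣ p ℚ.- r ∣ ℚ.≤ ∣ p ℚ.- q ∣ ℚ.+ ∣ q ℚ.- r ∣
  triangle p q r = ≡.subst (λ t → ∣ t ∣ ℚ.≤ ∣ p ℚ.- q ∣ ℚ.+ ∣ q ℚ.- r ∣)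
    (solve 3 (λ p q r → (p :- q) :+ (q :- r) := p :- r) ≡.refl p q r)
    (ℚ.∣p+q∣≤∣p∣+∣q∣ (p ℚ.- q) (q ℚ.- r))

  triangle-< : ∀ {ε} p q r → ∣ p ℚ.- q ∣ ℚ.< ½ ℚ.* ε → ∣ q ℚ.- r ∣ ℚ.< ½ ℚ.* ε →
               ∣ p ℚ.- r ∣ ℚ.< ε
  triangle-< {ε} p q r pq qr = ≡.subst (∣ p ℚ.- r ∣ ℚ.<_) (half+half ε)
    (ℚ.≤-<-trans (triangle p q r) (ℚ.+-mono-< pq qr))

  ∣-∣-sym : ∀ p q → ∣ p ℚ.- q ∣ ≡ ∣ q ℚ.- p ∣
  ∣-∣-sym p q = ≡.trans (≡.sym (ℚ.∣-p∣≡∣p∣ (p ℚ.- q)))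
    (≡.cong ∣_∣ (solve 2 (λ p q → :- (p :- q) := q :- p) ≡.refl p q))

  ∣p-p∣≡0 : ∀ p → ∣ p ℚ.- p ∣ ≡ 0ℚ
  ∣p-p∣≡0 p = ≡.cong ∣_∣ (ℚ.+-inverseʳ p)

  *-mono-∣ : ∀ {a M} b {δ} → ∣ a ∣ ℚ.≤ M → 0ℚ ℚ.< M → ∣ b ∣ ℚ.< δ → ∣ a ∣ ℚ.* ∣ b ∣ ℚ.< M ℚ.* δ
  *-mono-∣ {a} {M} b a≤M M>0 b<δ = ℚ.≤-<-trans
    (ℚ.*-monoʳ-≤-nonNeg ∣ b ∣ {{ℚ.∣-∣-nonNeg b}} a≤M)
    (ℚ.*-monoʳ-<-pos M {{ℚ.positive M>0}} b<δ)

  *-close : ∀ {a a′ b b′ M M′ δ δ′ ε} → 0ℚ ℚ.< M → 0ℚ ℚ.< M′ →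
            M ℚ.* δ ≡ ½ ℚ.* ε → M′ ℚ.* δ′ ≡ ½ ℚ.* ε →
            ∣ a ∣ ℚ.≤ M → ∣ b′ ∣ ℚ.≤ M′ → ∣ b ℚ.- b′ ∣ ℚ.< δ → ∣ a ℚ.- a′ ∣ ℚ.< δ′ →
            ∣ a ℚ.* b ℚ.- a′ ℚ.* b′ ∣ ℚ.< ε
  *-close {a} {a′} {b} {b′} {M} {M′} {δ} {δ′} {ε} M>0 M′>0 Mδ M′δ′ a≤M b′≤M′ bb′ aa′ =
    triangle-< (a ℚ.* b) (a ℚ.* b′) (a′ ℚ.* b′)
      (≡.subst₂ ℚ._<_
        (≡.trans (≡.sym (ℚ.∣p*q∣≡∣p∣*∣q∣ a (b ℚ.- b′)))
          (≡.cong ∣_∣ (factorˡ a b b′)))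
        Mδ (*-mono-∣ (b ℚ.- b′) a≤M M>0 bb′))
      (≡.subst₂ ℚ._<_
        (≡.trans (≡.sym (ℚ.∣p*q∣≡∣p∣*∣q∣ b′ (a ℚ.- a′)))
          (≡.cong ∣_∣ (factorʳ a a′ b′)))
        M′δ′ (*-mono-∣ (a ℚ.- a′) b′≤M′ M′>0 aa′))

open RationalLemmas

∃⇒eventually : ∀ {P Q : ℕ → Set} → (∀ {n} → P n → Q n) → Eventually P → Eventually Q
∃⇒eventually f (N , p) = N , λ n N≤n → f (p n N≤n)

both : ∀ {P Q R : ℕ → Set} → (∀ {n} → P n → Q n → R n) →
       Eventually P → Eventually Q → Eventually R
both f (N , p) (M , q) = N ℕ.⊔ M , λ n N⊔M≤n →
  f (p n (ℕ.≤-trans (ℕ.m≤m⊔n N M) N⊔M≤n)) (q n (ℕ.≤-trans (ℕ.m≤n⊔m N M) N⊔M≤n))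

pointwise : ∀ {x y} → (∀ n → seq x n ≡ seq y n) → x ≈ʳ y
pointwise {x} {y} eq .close {ε} ε>0 = 0 , λ n _ →
  ≡.subst (ℚ._< ε) (≡.sym (≡.trans (≡.cong (λ t → ∣ seq x n ℚ.- t ∣) (≡.sym (eq n))) (∣p-p∣≡0 (seq x n)))) ε>0

≈ʳ-refl : ∀ {x} → x ≈ʳ x
≈ʳ-refl = pointwise λ _ → ≡.refl

≈ʳ-sym : ∀ {x y} → x ≈ʳ y → y ≈ʳ x
≈ʳ-sym {x} {y} x≈y .close {ε} ε>0 =
  ∃⇒eventually (λ {n} → ≡.subst (ℚ._< ε) (∣-∣-sym (seq x n) (seq y n))) (close x≈y ε>0)

≈ʳ-trans : ∀ {x y z} → x ≈ʳ y → y ≈ʳ z → x ≈ʳ z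
≈ʳ-trans {x} {y} {z} x≈y y≈z .close ε>0 =
  both (λ {n} → triangle-< (seq x n) (seq y n) (seq z n))
    (close x≈y (half>0 ε>0)) (close y≈z (half>0 ε>0))

bounded : ∀ x → ∃ λ M → 0ℚ ℚ.< M ∧ Eventually λ n → ∣ seq x n ∣ ℚ.≤ M
bounded x = let N , close₁ = cauchy x (ℚ.positive⁻¹ 1ℚ) in 1ℚ ℚ.+ ∣ seq x N ∣ ,
  ℚ.<-≤-trans (ℚ.positive⁻¹ 1ℚ) (≡.subst (ℚ._≤ 1ℚ ℚ.+ ∣ seq x N ∣) (ℚ.+-identityʳ 1ℚ)
     (ℚ.+-monoʳ-≤ 1ℚ (ℚ.0≤∣p∣ (seq x N)))) ,
  N , λ n N≤n → ℚ.≤-trans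
    (≡.subst (ℚ._≤ ∣ seq x n ℚ.- seq x N ∣ ℚ.+ ∣ seq x N ∣)
      (≡.cong ∣_∣ (minus-cancel (seq x n) (seq x N)))
      (ℚ.∣p+q∣≤∣p∣+∣q∣ (seq x n ℚ.- seq x N) (seq x N)))
    (ℚ.+-monoˡ-≤ ∣ seq x N ∣ (ℚ.<⇒≤ (close₁ n N N≤n ℕ.≤-refl)))

infixl 6 _+ʳ_
infixl 7 _*ʳ_
infix  8 -ʳ_

ratʳ : ℚ → ℝ
ratʳ p .seq _ = p
ratʳ p .cauchy {ε} ε>0 = 0 , λ _ _ _ _ → ≡.subst (ℚ._< ε) (≡.sym (∣p-p∣≡0 p)) ε>0

-ʳ_ : ℝ → ℝ
(-ʳ x) .seq n = ℚ.- seq x n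
(-ʳ x) .cauchy {ε} ε>0 = let N , c = cauchy x ε>0 in N , λ m n N≤m N≤n → ≡.subst (ℚ._< ε)
  (≡.trans (∣-∣-sym (seq x m) (seq x n))
    (≡.cong ∣_∣ (minus-flip (seq x m) (seq x n))))
  (c m n N≤m N≤n)

+-close : ∀ {ε} a a′ b b′ → ∣ a ℚ.- a′ ∣ ℚ.< ½ ℚ.* ε → ∣ b ℚ.- b′ ∣ ℚ.< ½ ℚ.* ε →
          ∣ (a ℚ.+ b) ℚ.- (a′ ℚ.+ b′) ∣ ℚ.< ε
+-close a a′ b b′ aa′ bb′ = triangle-< (a ℚ.+ b) (a′ ℚ.+ b) (a′ ℚ.+ b′)
  (≡.subst (ℚ._< _) (≡.cong ∣_∣ (minus-shiftʳ a a′ b)) aa′)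
  (≡.subst (ℚ._< _) (≡.cong ∣_∣ (minus-shiftˡ a′ b b′)) bb′)

≤⊔ˡ : ∀ {a b n} → a ℕ.⊔ b ℕ.≤ n → a ℕ.≤ n
≤⊔ˡ {a} {b} = ℕ.≤-trans (ℕ.m≤m⊔n a b)

≤⊔ʳ : ∀ {a b n} → a ℕ.⊔ b ℕ.≤ n → b ℕ.≤ n
≤⊔ʳ {a} {b} = ℕ.≤-trans (ℕ.m≤n⊔m a b)

_+ʳ_ : ℝ → ℝ → ℝ
(x +ʳ y) .seq n = seq x n ℚ.+ seq y n
(x +ʳ y) .cauchy {ε} ε>0 =
  let N , c = cauchy x (half>0 ε>0)
      M , d = cauchy y (half>0 ε>0) in
  N ℕ.⊔ M , λ m n ≤m ≤n →
  +-close (seq x m) (seq x n) (seq y m) (seq y n)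
    (c m n (≤⊔ˡ {N} {M} ≤m) (≤⊔ˡ {N} {M} ≤n)) (d m n (≤⊔ʳ {N} {M} ≤m) (≤⊔ʳ {N} {M} ≤n))

_*ʳ_ : ℝ → ℝ → ℝ
(x *ʳ y) .seq n = seq x n ℚ.* seq y n
(x *ʳ y) .cauchy {ε} ε>0 =
  let M , M>0 , A , a = bounded x
      M′ , M′>0 , B , b = bounded y
      δ , δ>0 , Mδ = divide M>0 (half>0 ε>0)
      δ′ , δ′>0 , M′δ′ = divide M′>0 (half>0 ε>0)
      C , c = cauchy y δ>0
      D , d = cauchy x δ′>0 in
  (A ℕ.⊔ B) ℕ.⊔ (C ℕ.⊔ D) , λ m n ≤m ≤n →
  *-close M>0 M′>0 Mδ M′δ′
    (a m (≤⊔ˡ {A} {B} (≤⊔ˡ {A ℕ.⊔ B} {C ℕ.⊔ D} ≤m)))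
    (b n (≤⊔ʳ {A} {B} (≤⊔ˡ {A ℕ.⊔ B} {C ℕ.⊔ D} ≤n)))
    (c m n (≤⊔ˡ {C} {D} (≤⊔ʳ {A ℕ.⊔ B} {C ℕ.⊔ D} ≤m)) (≤⊔ˡ {C} {D} (≤⊔ʳ {A ℕ.⊔ B} {C ℕ.⊔ D} ≤n)))
    (d m n (≤⊔ʳ {C} {D} (≤⊔ʳ {A ℕ.⊔ B} {C ℕ.⊔ D} ≤m)) (≤⊔ʳ {C} {D} (≤⊔ʳ {A ℕ.⊔ B} {C ℕ.⊔ D} ≤n)))

-ʳ-cong : ∀ {x y} → x ≈ʳ y → -ʳ x ≈ʳ -ʳ y
-ʳ-cong {x} {y} x≈y .close {ε} ε>0 = ∃⇒eventually
  (λ {n} → ≡.subst (ℚ._< ε) (≡.trans (∣-∣-sym (seq x n) (seq y n))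
    (≡.cong ∣_∣ (minus-flip (seq x n) (seq y n)))))
  (close x≈y ε>0)

+ʳ-cong : ∀ {x x′ y y′} → x ≈ʳ x′ → y ≈ʳ y′ → x +ʳ y ≈ʳ x′ +ʳ y′
+ʳ-cong {x} {x′} {y} {y′} x≈x′ y≈y′ .close ε>0 =
  both (λ {n} → +-close (seq x n) (seq x′ n) (seq y n) (seq y′ n))
    (close x≈x′ (half>0 ε>0)) (close y≈y′ (half>0 ε>0))

*ʳ-cong : ∀ {x x′ y y′} → x ≈ʳ x′ → y ≈ʳ y′ → x *ʳ y ≈ʳ x′ *ʳ y′
*ʳ-cong {x} {x′} {y} {y′} x≈x′ y≈y′ .close ε>0 =
  let M , M>0 , a = bounded x
      M′ , M′>0 , b = bounded y′
      δ , δ>0 , Mδ = divide M>0 (half>0 ε>0)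
      δ′ , δ′>0 , M′δ′ = divide M′>0 (half>0 ε>0) in
  both (λ {n} (p , q) (r , s) → *-close {a = seq x n} {a′ = seq x′ n} M>0 M′>0 Mδ M′δ′ p q r s)
    (both _,_ a b) (both _,_ (close y≈y′ δ>0) (close x≈x′ δ′>0))

#ʳ-irrefl : ∀ {x y} → x ≈ʳ y → ¬ x #ʳ y
#ʳ-irrefl x≈y (mk# δ δ>0 (N , d)) =
  let M , c = close x≈y δ>0 in ℚ.<-irrefl ≡.refl (ℚ.≤-<-trans (d (N ℕ.⊔ M) (ℕ.m≤m⊔n N M)) (c (N ℕ.⊔ M) (ℕ.m≤n⊔m N M)))

#ʳ-sym : ∀ {x y} → x #ʳ y → y #ʳ x
#ʳ-sym {x} {y} (mk# δ δ>0 d) =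
  mk# δ δ>0 (∃⇒eventually (λ {n} → ≡.subst (δ ℚ.≤_) (∣-∣-sym (seq x n) (seq y n))) d)

half<ε : ∀ {ε} → 0ℚ ℚ.< ε → ½ ℚ.* ε ℚ.< ε
half<ε {ε} ε>0 = ≡.subst₂ ℚ._<_ (ℚ.+-identityʳ (½ ℚ.* ε)) (half+half ε)
  (ℚ.+-monoʳ-< (½ ℚ.* ε) (half>0 ε>0))

separate : ∀ x y {ε} → 0ℚ ℚ.< ε → x #ʳ y ⊎ Eventually λ n → ∣ seq x n ℚ.- seq y n ∣ ℚ.< ε
separate x y {ε} ε>0 = decide (∣ d N ∣ ℚ.<? ½ ℚ.* ε)
  where
  d : ℕ → ℚ
  d n = seq x n ℚ.- seq y n
  settled : ∃ λ N → ∀ m n → N ℕ.≤ m → N ℕ.≤ n → ∣ d m ℚ.- d n ∣ ℚ.< ½ ℚ.* (½ ℚ.* ε)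
  settled = cauchy (x +ʳ -ʳ y) (half>0 (half>0 ε>0))
  N : ℕ
  N = proj₁ settled
  minus-zero : ∀ p → ∣ p ℚ.- 0ℚ ∣ ≡ ∣ p ∣
  minus-zero p = ≡.cong ∣_∣ (ℚ.+-identityʳ p)
  step : ∀ {η} p q → ∣ p ℚ.- q ∣ ℚ.< ½ ℚ.* η → ∣ q ∣ ℚ.< ½ ℚ.* η → ∣ p ∣ ℚ.< η
  step {η} p q pq q< = ≡.subst (ℚ._< η) (minus-zero p)
    (triangle-< p q 0ℚ pq (≡.subst (ℚ._< ½ ℚ.* η) (≡.sym (minus-zero q)) q<))
  decide : Dec (∣ d N ∣ ℚ.< ½ ℚ.* ε) → x #ʳ y ⊎ Eventually λ n → ∣ seq x n ℚ.- seq y n ∣ ℚ.< ε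
  decide (yes small) = inj₂ (N , λ n N≤n → step (d n) (d N)
    (ℚ.<-trans (proj₂ settled n N N≤n ℕ.≤-refl) (half<ε (half>0 ε>0))) small)
  decide (no large) = inj₁ (mk# (½ ℚ.* (½ ℚ.* ε)) (half>0 (half>0 ε>0)) (N , λ n N≤n →
    ℚ.≮⇒≥ λ close-n → large (step (d N) (d n) (proj₂ settled N n ℕ.≤-refl N≤n) close-n)))

#ʳ-tight : ∀ {x y} → ¬ x #ʳ y → x ≈ʳ y
#ʳ-tight {x} {y} ¬x#y .close ε>0 = [ (λ x#y → contradiction x#y ¬x#y) , id ]′ (separate x y ε>0)

#ʳ-cotrans : ∀ {x y} → x #ʳ y → ∀ z → x #ʳ z ⊎ z #ʳ y
#ʳ-cotrans {x} {y} (mk# δ δ>0 (N , d)) z = decide (separate x z (half>0 δ>0)) (separate z y (half>0 δ>0))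
  where
  Close : ℝ → ℝ → Set
  Close v w = Eventually λ n → ∣ seq v n ℚ.- seq w n ∣ ℚ.< ½ ℚ.* δ
  decide : x #ʳ z ⊎ Close x z → z #ʳ y ⊎ Close z y → x #ʳ z ⊎ z #ʳ y
  decide (inj₁ x#z) _          = inj₁ x#z
  decide (inj₂ _)   (inj₁ z#y) = inj₂ z#y
  decide (inj₂ xz)  (inj₂ zy)  =
    let M , e = both (λ {n} → triangle-< (seq x n) (seq z n) (seq y n)) xz zy in
    contradiction (e (N ℕ.⊔ M) (ℕ.m≤n⊔m N M))
      (ℚ.<-irrefl ≡.refl ∘ ℚ.≤-<-trans (d (N ℕ.⊔ M) (ℕ.m≤m⊔n N M)))

0ʳ 1ʳ : ℝ
0ʳ = ratʳ 0ℚ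
1ʳ = ratʳ 1ℚ

1#ʳ0 : 1ʳ #ʳ 0ʳ
1#ʳ0 = mk# 1ℚ (ℚ.positive⁻¹ 1ℚ) (0 , λ _ _ → ℚ.≤-refl)

#ʳ-resp : ∀ {x x′ y y′} → x ≈ʳ x′ → y ≈ʳ y′ → x #ʳ y → x′ #ʳ y′
#ʳ-resp {x} {x′} {y} {y′} x≈x′ y≈y′ x#y =
  [ (λ x#x′ → contradiction x#x′ (#ʳ-irrefl x≈x′))
  , (λ x′#y → [ id , (λ y′#y → contradiction y′#y (#ʳ-irrefl (≈ʳ-sym y≈y′))) ]′ (#ʳ-cotrans x′#y y′))
  ]′ (#ʳ-cotrans x#y x′)

#ʳ⇒-#0 : ∀ {x y} → x #ʳ y → (x +ʳ -ʳ y) #ʳ 0ʳ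
#ʳ⇒-#0 {x} {y} (mk# δ δ>0 d) = mk# δ δ>0
  (∃⇒eventually (λ {n} → ≡.subst (δ ℚ.≤_) (≡.cong ∣_∣ (≡.sym (ℚ.+-identityʳ (seq x n ℚ.- seq y n))))) d)

-#0⇒#ʳ : ∀ {x y} → (x +ʳ -ʳ y) #ʳ 0ʳ → x #ʳ y
-#0⇒#ʳ {x} {y} (mk# δ δ>0 d) = mk# δ δ>0
  (∃⇒eventually (λ {n} → ≡.subst (δ ℚ.≤_) (≡.cong ∣_∣ (ℚ.+-identityʳ (seq x n ℚ.- seq y n)))) d)

*#0⇒#0ˡ : ∀ x y → (x *ʳ y) #ʳ 0ʳ → x #ʳ 0ʳ
*#0⇒#0ˡ x y (mk# δ δ>0 d) =
  let M , M>0 , b = bounded y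
      γ , γ>0 , Mγ = divide M>0 δ>0 in
  mk# γ γ>0 (both (λ {n} p q → ≡.subst (γ ℚ.≤_) (≡.cong ∣_∣ (≡.sym (ℚ.+-identityʳ (seq x n))))
    (ℚ.*-cancelˡ-≤-pos M {{ℚ.positive M>0}}
      (≡.subst (ℚ._≤ M ℚ.* ∣ seq x n ∣) (≡.sym Mγ)
        (ℚ.≤-trans p
          (≡.subst (ℚ._≤ M ℚ.* ∣ seq x n ∣) (product-abs n)
            (ℚ.*-monoʳ-≤-nonNeg ∣ seq x n ∣ {{ℚ.∣-∣-nonNeg (seq x n)}} q)))))) d b)
  where
  product-abs : ∀ n → ∣ seq y n ∣ ℚ.* ∣ seq x n ∣ ≡ ∣ seq x n ℚ.* seq y n ℚ.- 0ℚ ∣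
  product-abs n = ≡.trans (≡.sym (ℚ.∣p*q∣≡∣p∣*∣q∣ (seq y n) (seq x n)))
    (≡.cong ∣_∣ (≡.trans (ℚ.*-comm (seq y n) (seq x n)) (≡.sym (ℚ.+-identityʳ (seq x n ℚ.* seq y n)))))

norm²#0 : ∀ x y → x #ʳ 0ʳ → (x *ʳ x +ʳ y *ʳ y) #ʳ 0ʳ
norm²#0 x y (mk# δ δ>0 d) = mk# (δ ℚ.* δ)
  (≡.subst (ℚ._< δ ℚ.* δ) (ℚ.*-zeroʳ δ) (ℚ.*-monoʳ-<-pos δ {{ℚ.positive δ>0}} δ>0))
  (∃⇒eventually bound d)
  where
  instance
    δ-nonNeg : ℚ.NonNegative δ
    δ-nonNeg = ℚ.nonNegative (ℚ.<⇒≤ δ>0)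
  square : ∀ p → ∣ p ∣ ℚ.* ∣ p ∣ ≡ p ℚ.* p
  square p with ℚ.∣p∣≡p∨∣p∣≡-p p
  ... | inj₁ e = ≡.cong₂ ℚ._*_ e e
  ... | inj₂ e = ≡.trans (≡.cong₂ ℚ._*_ e e) (neg-square p)
  square≥0 : ∀ p → 0ℚ ℚ.≤ p ℚ.* p
  square≥0 p = ≡.subst₂ ℚ._≤_ (ℚ.*-zeroʳ ∣ p ∣) (square p)
    (ℚ.*-monoˡ-≤-nonNeg ∣ p ∣ {{ℚ.∣-∣-nonNeg p}} (ℚ.0≤∣p∣ p))
  bound : ∀ {n} → δ ℚ.≤ ∣ seq x n ℚ.- 0ℚ ∣ →
          δ ℚ.* δ ℚ.≤ ∣ (seq x n ℚ.* seq x n ℚ.+ seq y n ℚ.* seq y n) ℚ.- 0ℚ ∣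
  bound {n} δ≤ = begin
    δ ℚ.* δ                       ≤⟨ ℚ.*-monoʳ-≤-nonNeg δ δ≤∣p∣ ⟩
    ∣ p ∣ ℚ.* δ                   ≤⟨ ℚ.*-monoˡ-≤-nonNeg ∣ p ∣ {{ℚ.∣-∣-nonNeg p}} δ≤∣p∣ ⟩
    ∣ p ∣ ℚ.* ∣ p ∣               ≡⟨ square p ⟩
    p ℚ.* p                       ≡⟨ ℚ.+-identityʳ (p ℚ.* p) ⟨
    p ℚ.* p ℚ.+ 0ℚ                ≤⟨ ℚ.+-monoʳ-≤ (p ℚ.* p) (square≥0 q) ⟩
    p ℚ.* p ℚ.+ q ℚ.* q           ≡⟨ ℚ.0≤p⇒∣p∣≡p (≡.subst (ℚ._≤ p ℚ.* p ℚ.+ q ℚ.* q) (ℚ.+-identityʳ 0ℚ) (ℚ.+-mono-≤ (square≥0 p) (square≥0 q))) ⟨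
    ∣ p ℚ.* p ℚ.+ q ℚ.* q ∣       ≡⟨ ≡.cong ∣_∣ (ℚ.+-identityʳ (p ℚ.* p ℚ.+ q ℚ.* q)) ⟨
    ∣ (p ℚ.* p ℚ.+ q ℚ.* q) ℚ.- 0ℚ ∣ ∎
    where
    open ℚ.≤-Reasoning
    p = seq x n
    q = seq y n
    δ≤∣p∣ : δ ℚ.≤ ∣ p ∣
    δ≤∣p∣ = ≡.subst (δ ℚ.≤_) (≡.cong ∣_∣ (ℚ.+-identityʳ p)) δ≤

reciprocal : ℚ → ℚ
reciprocal p with p ℚ.≟ 0ℚ
... | yes _  = 0ℚ
... | no p≢0 = (ℚ.1/ p) {{ℚ.≢-nonZero p≢0}}

*-reciprocal : ∀ {p} → ¬ p ≡ 0ℚ → p ℚ.* reciprocal p ≡ 1ℚ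
*-reciprocal {p} p≢0 with p ℚ.≟ 0ℚ
... | yes p≡0 = contradiction p≡0 p≢0
... | no p≢0′ = ℚ.*-inverseʳ p {{ℚ.≢-nonZero p≢0′}}

invertibleʳ : ∀ x → x #ʳ 0ʳ → ∃ λ r → x *ʳ r ≈ʳ 1ʳ
invertibleʳ x (mk# δ δ>0 (N , d)) = r , x*r≈1
  where
  instance
    δ-pos : ℚ.Positive δ
    δ-pos = ℚ.positive δ>0
  p = seq x
  u : ℕ → ℚ
  u n = reciprocal (p n)
  δ≤ : ∀ {n} → N ℕ.≤ n → δ ℚ.≤ ∣ p n ∣
  δ≤ {n} N≤n = ≡.subst (δ ℚ.≤_) (≡.cong ∣_∣ (ℚ.+-identityʳ (p n))) (d n N≤n)
  p*u≡1 : ∀ {n} → N ℕ.≤ n → p n ℚ.* u n ≡ 1ℚ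
  p*u≡1 N≤n = *-reciprocal λ p≡0 →
    ℚ.<-irrefl (≡.sym (≡.cong ∣_∣ p≡0)) (ℚ.<-≤-trans δ>0 (δ≤ N≤n))
  δu≤1 : ∀ {n} → N ℕ.≤ n → δ ℚ.* ∣ u n ∣ ℚ.≤ 1ℚ
  δu≤1 {n} N≤n = ≡.subst (δ ℚ.* ∣ u n ∣ ℚ.≤_)
    (≡.trans (≡.sym (ℚ.∣p*q∣≡∣p∣*∣q∣ (p n) (u n))) (≡.cong ∣_∣ (p*u≡1 N≤n)))
    (ℚ.*-monoʳ-≤-nonNeg ∣ u n ∣ {{ℚ.∣-∣-nonNeg (u n)}} (δ≤ N≤n))
  difference : ∀ {m n} → N ℕ.≤ m → N ℕ.≤ n → u m ℚ.- u n ≡ (u m ℚ.* u n) ℚ.* (p n ℚ.- p m)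
  difference {m} {n} N≤m N≤n = begin
    u m ℚ.- u n
      ≡⟨ insert-ones (u m) (u n) ⟩
    u m ℚ.* 1ℚ ℚ.- 1ℚ ℚ.* u n
      ≡⟨ ≡.cong₂ (λ s t → u m ℚ.* s ℚ.- t ℚ.* u n) (p*u≡1 N≤n) (p*u≡1 N≤m) ⟨
    u m ℚ.* (p n ℚ.* u n) ℚ.- (p m ℚ.* u m) ℚ.* u n
      ≡⟨ cross (u m) (u n) (p n) (p m) ⟩
    (u m ℚ.* u n) ℚ.* (p n ℚ.- p m) ∎
    where
    open ≡.≡-Reasoning
  scale>0 : ∀ {η} → 0ℚ ℚ.< η → 0ℚ ℚ.< δ ℚ.* η
  scale>0 {η} η>0 = ≡.subst (ℚ._< δ ℚ.* η) (ℚ.*-zeroʳ δ) (ℚ.*-monoʳ-<-pos δ η>0)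
  scale-cancel : ∀ {s t} → δ ℚ.* s ℚ.< δ ℚ.* t → s ℚ.< t
  scale-cancel = ℚ.*-cancelˡ-<-nonNeg δ {{ℚ.nonNegative (ℚ.<⇒≤ δ>0)}}
  abs-product : ∀ a b e → ∣ (a ℚ.* b) ℚ.* e ∣ ≡ (∣ a ∣ ℚ.* ∣ b ∣) ℚ.* ∣ e ∣
  abs-product a b e = ≡.trans (ℚ.∣p*q∣≡∣p∣*∣q∣ (a ℚ.* b) e)
    (≡.cong (ℚ._* ∣ e ∣) (ℚ.∣p*q∣≡∣p∣*∣q∣ a b))
  rearranged : ∀ a b t → 0ℚ ℚ.≤ t → δ ℚ.* ∣ a ∣ ℚ.≤ 1ℚ → δ ℚ.* ∣ b ∣ ℚ.≤ 1ℚ →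
               δ ℚ.* (δ ℚ.* ((∣ a ∣ ℚ.* ∣ b ∣) ℚ.* t)) ℚ.≤ t
  rearranged a b t t≥0 δa δb = begin
    δ ℚ.* (δ ℚ.* ((∣ a ∣ ℚ.* ∣ b ∣) ℚ.* t))
      ≡⟨ shuffle δ ∣ a ∣ ∣ b ∣ t ⟩
    (δ ℚ.* ∣ a ∣) ℚ.* ((δ ℚ.* ∣ b ∣) ℚ.* t)
      ≤⟨ ℚ.*-monoʳ-≤-nonNeg ((δ ℚ.* ∣ b ∣) ℚ.* t) {{ℚ.nonNegative δbt≥0}} δa ⟩
    1ℚ ℚ.* ((δ ℚ.* ∣ b ∣) ℚ.* t)  ≡⟨ ℚ.*-identityˡ _ ⟩
    (δ ℚ.* ∣ b ∣) ℚ.* t           ≤⟨ ℚ.*-monoʳ-≤-nonNeg t {{ℚ.nonNegative t≥0}} δb ⟩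
    1ℚ ℚ.* t                      ≡⟨ ℚ.*-identityˡ t ⟩
    t                             ∎
    where
    open ℚ.≤-Reasoning
    *-nonNeg : ∀ {s w} → 0ℚ ℚ.≤ s → 0ℚ ℚ.≤ w → 0ℚ ℚ.≤ s ℚ.* w
    *-nonNeg {s} {w} s≥0 w≥0 = ≡.subst (ℚ._≤ s ℚ.* w) (ℚ.*-zeroʳ s)
      (ℚ.*-monoˡ-≤-nonNeg s {{ℚ.nonNegative s≥0}} w≥0)
    δbt≥0 : 0ℚ ℚ.≤ (δ ℚ.* ∣ b ∣) ℚ.* t
    δbt≥0 = *-nonNeg (*-nonNeg (ℚ.<⇒≤ δ>0) (ℚ.0≤∣p∣ b)) t≥0
  r : ℝ
  r .seq = u
  r .cauchy {ε} ε>0 = N ℕ.⊔ M , λ m n ≤m ≤n →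
    let N≤m = ≤⊔ˡ {N} {M} ≤m ; N≤n = ≤⊔ˡ {N} {M} ≤n
        t = ∣ p n ℚ.- p m ∣ in
    ≡.subst (ℚ._< ε)
      (≡.sym (≡.trans (≡.cong ∣_∣ (difference N≤m N≤n)) (abs-product (u m) (u n) (p n ℚ.- p m))))
      (scale-cancel (scale-cancel (ℚ.≤-<-trans (rearranged (u m) (u n) t (ℚ.0≤∣p∣ (p n ℚ.- p m)) (δu≤1 N≤m) (δu≤1 N≤n))
        (proj₂ settled n m (≤⊔ʳ {N} {M} ≤n) (≤⊔ʳ {N} {M} ≤m)))))
    where
    settled : ∃ λ M → ∀ m n → M ℕ.≤ m → M ℕ.≤ n → ∣ p m ℚ.- p n ∣ ℚ.< δ ℚ.* (δ ℚ.* ε)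
    settled = cauchy x (scale>0 (scale>0 ε>0))
    M = proj₁ settled
  x*r≈1 : x *ʳ r ≈ʳ 1ʳ
  x*r≈1 .close {ε} ε>0 = N , λ n N≤n →
    ≡.subst (ℚ._< ε) (≡.sym (≡.trans (≡.cong (λ t → ∣ t ℚ.- 1ℚ ∣) (p*u≡1 N≤n)) (∣p-p∣≡0 1ℚ))) ε>0

infix 4 _≈ᶜ_

record ℂ : Set where
  no-eta-equality
  constructor _+i_
  field
    re im : ℝ

open ℂ public

record _≈ᶜ_ (z w : ℂ) : Set where
  constructor mk≈
  field
    re≈ : re z ≈ʳ re w
    im≈ : im z ≈ʳ im w

open _≈ᶜ_

infix 4 _#ᶜ_
data _#ᶜ_ (z w : ℂ) : Set where
  re# : re z #ʳ re w → z #ᶜ w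
  im# : im z #ʳ im w → z #ᶜ w

infixl 6 _+ᶜ_
infixl 7 _*ᶜ_
infix  8 -ᶜ_

_+ᶜ_ _*ᶜ_ : ℂ → ℂ → ℂ
z +ᶜ w = (re z +ʳ re w) +i (im z +ʳ im w)
z *ᶜ w = (re z *ʳ re w +ʳ -ʳ (im z *ʳ im w)) +i (re z *ʳ im w +ʳ im z *ʳ re w)

-ᶜ_ : ℂ → ℂ
-ᶜ z = (-ʳ re z) +i (-ʳ im z)

0ᶜ 1ᶜ : ℂ
0ᶜ = 0ʳ +i 0ʳ
1ᶜ = 1ʳ +i 0ʳ

module ComplexLaws where
  open +-*-Solver

  private
    infixl 6 _+_ _-_
    infixl 7 _*_
    _+_ _*_ _-_ : ℚ → ℚ → ℚ
    _+_ = ℚ._+_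
    _*_ = ℚ._*_
    _-_ = ℚ._-_

  *-assoc-re : ∀ a b c d e f →
    (a * c - b * d) * e - (a * d + b * c) * f ≡ a * (c * e - d * f) - b * (c * f + d * e)
  *-assoc-re = solve 6 (λ a b c d e f →
    (a :* c :- b :* d) :* e :- (a :* d :+ b :* c) :* f :=
    a :* (c :* e :- d :* f) :- b :* (c :* f :+ d :* e)) ≡.refl

  *-assoc-im : ∀ a b c d e f →
    (a * c - b * d) * f + (a * d + b * c) * e ≡ a * (c * f + d * e) + b * (c * e - d * f)
  *-assoc-im = solve 6 (λ a b c d e f →
    (a :* c :- b :* d) :* f :+ (a :* d :+ b :* c) :* e :=
    a :* (c :* f :+ d :* e) :+ b :* (c :* e :- d :* f)) ≡.refl

  *-distribˡ-re : ∀ a b c d e f →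
    a * (c + e) - b * (d + f) ≡ (a * c - b * d) + (a * e - b * f)
  *-distribˡ-re = solve 6 (λ a b c d e f →
    a :* (c :+ e) :- b :* (d :+ f) := (a :* c :- b :* d) :+ (a :* e :- b :* f)) ≡.refl

  *-distribˡ-im : ∀ a b c d e f →
    a * (d + f) + b * (c + e) ≡ (a * d + b * c) + (a * f + b * e)
  *-distribˡ-im = solve 6 (λ a b c d e f →
    a :* (d :+ f) :+ b :* (c :+ e) := (a :* d :+ b :* c) :+ (a :* f :+ b :* e)) ≡.refl

  *-comm-re : ∀ a b c d → a * c - b * d ≡ c * a - d * b
  *-comm-re = solve 4 (λ a b c d → a :* c :- b :* d := c :* a :- d :* b) ≡.refl

  *-comm-im : ∀ a b c d → a * d + b * c ≡ c * b + d * a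
  *-comm-im = solve 4 (λ a b c d → a :* d :+ b :* c := c :* b :+ d :* a) ≡.refl

  *-identityˡ-re : ∀ a b → 1ℚ * a - 0ℚ * b ≡ a
  *-identityˡ-re = solve 2 (λ a b → con 1ℚ :* a :- con 0ℚ :* b := a) ≡.refl

  *-identityˡ-im : ∀ a b → 1ℚ * b + 0ℚ * a ≡ b
  *-identityˡ-im = solve 2 (λ a b → con 1ℚ :* b :+ con 0ℚ :* a := b) ≡.refl

  inverse-re : ∀ a b r → a * (a * r) - b * (ℚ.- b * r) ≡ (a * a + b * b) * r
  inverse-re = solve 3 (λ a b r →
    a :* (a :* r) :- b :* (:- b :* r) := (a :* a :+ b :* b) :* r) ≡.refl

  inverse-im : ∀ a b r → a * (ℚ.- b * r) + b * (a * r) ≡ 0ℚ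
  inverse-im = solve 3 (λ a b r → a :* (:- b :* r) :+ b :* (a :* r) := con 0ℚ) ≡.refl

  +-comm-sq : ∀ a b → b * b + a * a ≡ a * a + b * b
  +-comm-sq a b = ℚ.+-comm (b * b) (a * a)

open ComplexLaws

pointwiseᶜ : ∀ {z w} → (∀ n → seq (re z) n ≡ seq (re w) n) → (∀ n → seq (im z) n ≡ seq (im w) n) → z ≈ᶜ w
pointwiseᶜ p q = mk≈ (pointwise p) (pointwise q)

≈ᶜ-isEquivalence : IsEquivalence _≈ᶜ_
≈ᶜ-isEquivalence = record
  { refl  = mk≈ ≈ʳ-refl ≈ʳ-refl
  ; sym   = λ p → mk≈ (≈ʳ-sym (re≈ p)) (≈ʳ-sym (im≈ p))
  ; trans = λ p q → mk≈ (≈ʳ-trans (re≈ p) (re≈ q)) (≈ʳ-trans (im≈ p) (im≈ q))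
  }

*ᶜ-cong : ∀ {x y u v} → x ≈ᶜ y → u ≈ᶜ v → x *ᶜ u ≈ᶜ y *ᶜ v
*ᶜ-cong p q = mk≈ (+ʳ-cong (*ʳ-cong (re≈ p) (re≈ q)) (-ʳ-cong (*ʳ-cong (im≈ p) (im≈ q))))
                  (+ʳ-cong (*ʳ-cong (re≈ p) (im≈ q)) (*ʳ-cong (im≈ p) (re≈ q)))

*ᶜ-comm : ∀ x y → x *ᶜ y ≈ᶜ y *ᶜ x
*ᶜ-comm x y = pointwiseᶜ
  (λ n → *-comm-re (seq (re x) n) (seq (im x) n) (seq (re y) n) (seq (im y) n))
  (λ n → *-comm-im (seq (re x) n) (seq (im x) n) (seq (re y) n) (seq (im y) n))

+ᶜ-*ᶜ-isCommutativeRing : IsCommutativeRing _≈ᶜ_ _+ᶜ_ _*ᶜ_ -ᶜ_ 0ᶜ 1ᶜ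
+ᶜ-*ᶜ-isCommutativeRing = record
  { isRing = record
    { +-isAbelianGroup = record
      { isGroup = record
        { isMonoid = record
          { isSemigroup = record
            { isMagma = record
              { isEquivalence = ≈ᶜ-isEquivalence
              ; ∙-cong = λ p q → mk≈ (+ʳ-cong (re≈ p) (re≈ q)) (+ʳ-cong (im≈ p) (im≈ q))
              }
            ; assoc = λ x y z → pointwiseᶜ
                (λ n → ℚ.+-assoc (seq (re x) n) (seq (re y) n) (seq (re z) n))
                (λ n → ℚ.+-assoc (seq (im x) n) (seq (im y) n) (seq (im z) n))
            }
          ; identity = (λ x → pointwiseᶜ (λ n → ℚ.+-identityˡ (seq (re x) n)) (λ n → ℚ.+-identityˡ (seq (im x) n)))
                     , (λ x → pointwiseᶜ (λ n → ℚ.+-identityʳ (seq (re x) n)) (λ n → ℚ.+-identityʳ (seq (im x) n)))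
          }
        ; inverse = (λ x → pointwiseᶜ (λ n → ℚ.+-inverseˡ (seq (re x) n)) (λ n → ℚ.+-inverseˡ (seq (im x) n)))
                  , (λ x → pointwiseᶜ (λ n → ℚ.+-inverseʳ (seq (re x) n)) (λ n → ℚ.+-inverseʳ (seq (im x) n)))
        ; ⁻¹-cong = λ p → mk≈ (-ʳ-cong (re≈ p)) (-ʳ-cong (im≈ p))
        }
      ; comm = λ x y → pointwiseᶜ (λ n → ℚ.+-comm (seq (re x) n) (seq (re y) n)) (λ n → ℚ.+-comm (seq (im x) n) (seq (im y) n))
      }
    ; *-cong = *ᶜ-cong
    ; *-assoc = λ x y z → pointwiseᶜ
        (λ n → *-assoc-re (seq (re x) n) (seq (im x) n) (seq (re y) n) (seq (im y) n) (seq (re z) n) (seq (im z) n))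
        (λ n → *-assoc-im (seq (re x) n) (seq (im x) n) (seq (re y) n) (seq (im y) n) (seq (re z) n) (seq (im z) n))
    ; *-identity = identityˡ , λ x → ≈ᶜ.trans (*ᶜ-comm x 1ᶜ) (identityˡ x)
    ; distrib = distribˡ , λ x y z → ≈ᶜ.trans (*ᶜ-comm (y +ᶜ z) x)
        (≈ᶜ.trans (distribˡ x y z) (+ᶜ-cong (*ᶜ-comm x y) (*ᶜ-comm x z)))
    }
  ; *-comm = *ᶜ-comm
  }
  where
  module ≈ᶜ = IsEquivalence ≈ᶜ-isEquivalence
  +ᶜ-cong : ∀ {x y u v} → x ≈ᶜ y → u ≈ᶜ v → x +ᶜ u ≈ᶜ y +ᶜ v
  +ᶜ-cong p q = mk≈ (+ʳ-cong (re≈ p) (re≈ q)) (+ʳ-cong (im≈ p) (im≈ q))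
  identityˡ : ∀ x → 1ᶜ *ᶜ x ≈ᶜ x
  identityˡ x = pointwiseᶜ
    (λ n → *-identityˡ-re (seq (re x) n) (seq (im x) n))
    (λ n → *-identityˡ-im (seq (re x) n) (seq (im x) n))
  distribˡ : ∀ x y z → x *ᶜ (y +ᶜ z) ≈ᶜ x *ᶜ y +ᶜ x *ᶜ z
  distribˡ x y z = pointwiseᶜ
    (λ n → *-distribˡ-re (seq (re x) n) (seq (im x) n) (seq (re y) n) (seq (im y) n) (seq (re z) n) (seq (im z) n))
    (λ n → *-distribˡ-im (seq (re x) n) (seq (im x) n) (seq (re y) n) (seq (im y) n) (seq (re z) n) (seq (im z) n))

#ᶜ-isApartness : IsApartnessRelation _≈ᶜ_ _#ᶜ_
#ᶜ-isApartness = record { irrefl = irrefl ; sym = sym ; cotrans = cotrans }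
  where
  irrefl : ∀ {z w} → z ≈ᶜ w → ¬ z #ᶜ w
  irrefl z≈w (re# p) = #ʳ-irrefl (re≈ z≈w) p
  irrefl z≈w (im# p) = #ʳ-irrefl (im≈ z≈w) p
  sym : ∀ {z w} → z #ᶜ w → w #ᶜ z
  sym (re# p) = re# (#ʳ-sym p)
  sym (im# p) = im# (#ʳ-sym p)
  cotrans : ∀ {z w} → z #ᶜ w → ∀ v → z #ᶜ v ⊎ v #ᶜ w
  cotrans (re# p) v = Sum.map re# re# (#ʳ-cotrans p (re v))
  cotrans (im# p) v = Sum.map im# im# (#ʳ-cotrans p (im v))

#0⇒invertible : ∀ z → z #ᶜ 0ᶜ → Invertible _≈ᶜ_ 1ᶜ _*ᶜ_ z
#0⇒invertible z z#0 = z⁻¹ , ≈ᶜ.trans (*ᶜ-comm z⁻¹ z) z*z⁻¹≈1 , z*z⁻¹≈1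
  where
  module ≈ᶜ = IsEquivalence ≈ᶜ-isEquivalence
  a b norm² : ℝ
  a = re z
  b = im z
  norm² = a *ʳ a +ʳ b *ʳ b
  norm²≠0 : z #ᶜ 0ᶜ → norm² #ʳ 0ʳ
  norm²≠0 (re# a#0) = norm²#0 a b a#0
  norm²≠0 (im# b#0) = #ʳ-resp (pointwise λ n → +-comm-sq (seq a n) (seq b n)) ≈ʳ-refl (norm²#0 b a b#0)
  r : ℝ
  r = proj₁ (invertibleʳ norm² (norm²≠0 z#0))
  z⁻¹ : ℂ
  z⁻¹ = (a *ʳ r) +i (-ʳ b *ʳ r)
  z*z⁻¹≈1 : z *ᶜ z⁻¹ ≈ᶜ 1ᶜ
  z*z⁻¹≈1 = mk≈
    (≈ʳ-trans (pointwise λ n → inverse-re (seq a n) (seq b n) (seq r n)) (proj₂ (invertibleʳ norm² (norm²≠0 z#0))))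
    (pointwise λ n → inverse-im (seq a n) (seq b n) (seq r n))

invertible⇒#0 : ∀ z → Invertible _≈ᶜ_ 1ᶜ _*ᶜ_ z → z #ᶜ 0ᶜ
invertible⇒#0 z (w , _ , zw≈1) =
  [ (λ P#0 → re# (*#0⇒#0ˡ (re z) (re w) P#0))
  , (λ 0#Q → im# (*#0⇒#0ˡ (im z) (im w) (#ʳ-sym 0#Q)))
  ]′ (#ʳ-cotrans (-#0⇒#ʳ (#ʳ-resp (≈ʳ-sym (re≈ zw≈1)) ≈ʳ-refl 1#ʳ0)) 0ʳ)

ℂ-isHeytingField : IsHeytingField _≈ᶜ_ _#ᶜ_ _+ᶜ_ _*ᶜ_ -ᶜ_ 0ᶜ 1ᶜ
ℂ-isHeytingField = record
  { isHeytingCommutativeRing = record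
    { isCommutativeRing   = +ᶜ-*ᶜ-isCommutativeRing
    ; isApartnessRelation = #ᶜ-isApartness
    ; #⇒invertible        = λ {x} {y} x#y → #0⇒invertible (x +ᶜ -ᶜ y) (to-#0 x#y)
    ; invertible⇒#        = λ {x} {y} inv → from-#0 (invertible⇒#0 (x +ᶜ -ᶜ y) inv)
    }
  ; tight = λ _ _ → (λ ¬z#w → mk≈ (#ʳ-tight (¬z#w ∘ re#)) (#ʳ-tight (¬z#w ∘ im#)))
                  , IsApartnessRelation.irrefl #ᶜ-isApartness
  }
  where
  to-#0 : ∀ {x y} → x #ᶜ y → (x +ᶜ -ᶜ y) #ᶜ 0ᶜ
  to-#0 (re# p) = re# (#ʳ⇒-#0 p)
  to-#0 (im# p) = im# (#ʳ⇒-#0 p)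
  from-#0 : ∀ {x y} → (x +ᶜ -ᶜ y) #ᶜ 0ᶜ → x #ᶜ y
  from-#0 (re# p) = re# (-#0⇒#ʳ p)
  from-#0 (im# p) = im# (-#0⇒#ʳ p)

ℂ-heytingField : HeytingField 0ℓ 0ℓ 0ℓ
ℂ-heytingField = record { isHeytingField = ℂ-isHeytingField }

commutativeRing : ∀ {c ℓ₁ ℓ₂} → HeytingField c ℓ₁ ℓ₂ → CommutativeRing c ℓ₁
commutativeRing K = HeytingCommutativeRing.commutativeRing (HeytingField.heytingCommutativeRing K)

module FieldNotation {c ℓ₁ ℓ₂} (K : HeytingField c ℓ₁ ℓ₂) where
  open HeytingField K public using (_#_; tight; #-irrefl; #-sym; #-cotrans; #⇒invertible; invertible⇒#)
  open CommutativeRing (commutativeRing K) public hiding (_≉_; zero)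
  open import Algebra.Definitions.RawSemiring (Semiring.rawSemiring semiring) public using (_×_; _^_; product)
  open import Algebra.Properties.Semiring.Sum semiring public
    using (sum; sum-syntax; sum-cong-≋; sum-replicate; sum-replicate-zero;
           ∑-distrib-+; ∑-comm; ∑-permute; *-distribˡ-sum; *-distribʳ-sum)

CharacteristicZero : ∀ {c ℓ₁ ℓ₂} → HeytingField c ℓ₁ ℓ₂ → Set ℓ₂
CharacteristicZero K = ∀ n → .{{NonZero n}} → (n × 1#) # 0#
  where open FieldNotation K

ℂ-characteristicZero : CharacteristicZero ℂ-heytingField
ℂ-characteristicZero (suc n) = re# (mk# 1ℚ (ℚ.positive⁻¹ 1ℚ) (0 , λ k _ →
  ≡.subst (1ℚ ℚ.≤_) (≡.sym (≡.trans (≡.cong ∣_∣ (ℚ.+-identityʳ (part (suc n) k))) (ℚ.0≤p⇒∣p∣≡p (ℚ.≤-trans (ℚ.<⇒≤ (ℚ.positive⁻¹ 1ℚ)) (≥1 n k)))))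
    (≥1 n k)))
  where
  open FieldNotation ℂ-heytingField using (_×_)
  part : ℕ → ℕ → ℚ
  part m k = seq (re (m × 1ᶜ)) k
  ≥0 : ∀ m k → 0ℚ ℚ.≤ part m k
  ≥1 : ∀ m k → 1ℚ ℚ.≤ part (suc m) k
  ≥0 zero    k = ℚ.≤-refl
  ≥0 (suc m) k = ℚ.≤-trans (ℚ.<⇒≤ (ℚ.positive⁻¹ 1ℚ)) (≥1 m k)
  ≥1 m k = ≡.subst (ℚ._≤ part (suc m) k) (ℚ.+-identityʳ 1ℚ) (ℚ.+-monoʳ-≤ 1ℚ (≥0 m k))

Enumeration : ∀ {c ℓ} → Setoid c ℓ → ℕ → Set (c ⊔ ℓ)
Enumeration S n = Inverse (≡.setoid (Fin n)) S

decide-all : ∀ {a b n} {P : Fin n → Set a} {Q : Fin n → Set b} →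
             (∀ i → P i ⊎ Q i) → ∃ P ⊎ (∀ i → Q i)
decide-all {n = zero}  _ = inj₂ λ ()
decide-all {n = suc n} {P} {Q} d with d zero | decide-all (d ∘ suc)
... | inj₁ p | _            = inj₁ (zero , p)
... | inj₂ _ | inj₁ (i , p) = inj₁ (suc i , p)
... | inj₂ q | inj₂ qs      = inj₂ λ { zero → q ; (suc i) → qs i }

module FieldLemmas {c ℓ₁ ℓ₂} (K : HeytingField c ℓ₁ ℓ₂) where
  open FieldNotation K
  open import Algebra.Properties.Ring ring
  open import Algebra.Properties.Semiring.Exp semiring using (^-homo-*; ^-congˡ; ^-congʳ)
  open import Algebra.Apartness.Properties.HeytingCommutativeRing
    (HeytingField.heytingCommutativeRing K) using (x-0≈x; 1#0; x#0y#0→xy#0; #-congʳ; #-congˡ) public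
  open ≈-Reasoning setoid

  inverse : ∀ {x} → x # 0# → Carrier
  inverse x#0 = proj₁ (#⇒invertible x#0)

  *-inverseʳ : ∀ {x} (x#0 : x # 0#) → x * inverse x#0 ≈ 1#
  *-inverseʳ {x} x#0 = trans (*-congʳ (sym (x-0≈x x))) (proj₂ (proj₂ (#⇒invertible x#0)))

  rightInvertible⇒#0 : ∀ {x y} → x * y ≈ 1# → x # 0#
  rightInvertible⇒#0 {x} {y} xy≈1 = invertible⇒# (y , trans (*-comm y _) eq , eq)
    where
    eq : (x - 0#) * y ≈ 1#
    eq = trans (*-congʳ (x-0≈x x)) xy≈1

  infixl 7 _/_[_]
  _/_[_] : ∀ x y → y # 0# → Carrier
  x / _ [ y#0 ] = x * inverse y#0

  x*y#0⇒x#0 : ∀ {x y} → x * y # 0# → x # 0#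
  x*y#0⇒x#0 {x} {y} xy#0 = rightInvertible⇒#0 (trans (sym (*-assoc x y _)) (*-inverseʳ xy#0))

  #⇒-#0 : ∀ {x y} → x # y → x - y # 0#
  #⇒-#0 {x} {y} x#y = rightInvertible⇒#0 (proj₂ (proj₂ (#⇒invertible x#y)))

  -#0⇒# : ∀ {x y} → x - y # 0# → x # y
  -#0⇒# {x} {y} p = invertible⇒# (inverse p , trans (*-comm _ _) (*-inverseʳ p) , *-inverseʳ p)

  cancelˡ : ∀ {x y z} → x # 0# → x * y ≈ x * z → y ≈ z
  cancelˡ {x} {y} {z} x#0 xy≈xz = begin
    y                        ≈⟨ unit y ⟨
    inverse x#0 * (x * y)    ≈⟨ *-congˡ xy≈xz ⟩
    inverse x#0 * (x * z)    ≈⟨ unit z ⟩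
    z                        ∎
    where
    unit : ∀ w → inverse x#0 * (x * w) ≈ w
    unit w = trans (sym (*-assoc _ x w))
      (trans (*-congʳ (trans (*-comm _ x) (*-inverseʳ x#0))) (*-identityˡ w))

  x*y≈0⇒y≈0 : ∀ {x y} → x # 0# → x * y ≈ 0# → y ≈ 0#
  x*y≈0⇒y≈0 {x} x#0 xy≈0 = cancelˡ x#0 (trans xy≈0 (sym (zeroʳ x)))

  fixed⇒0 : ∀ {x s} → x # 1# → x * s ≈ s → s ≈ 0#
  fixed⇒0 {x} {s} x#1 xs≈s = x*y≈0⇒y≈0 (#⇒-#0 x#1) (begin
    (x - 1#) * s         ≈⟨ distribʳ s x (- 1#) ⟩
    x * s + - 1# * s     ≈⟨ +-cong xs≈s (-1*x≈-x s) ⟩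
    s - s                ≈⟨ -‿inverseʳ s ⟩
    0#                   ∎)

  -1#0 : - 1# # 0#
  -1#0 = rightInvertible⇒#0 (trans (-1*x≈-x (- 1#)) (-‿involutive 1#))

  geometric : Carrier → ℕ → Carrier
  geometric z zero    = 0#
  geometric z (suc n) = 1# + z * geometric z n

  *-telescope : ∀ z t → (1# - z) * t + z * t ≈ t
  *-telescope z t = begin
    (1# - z) * t + z * t ≈⟨ distribʳ t (1# - z) z ⟨
    (1# - z + z) * t     ≈⟨ *-congʳ (trans (+-assoc 1# (- z) z) (trans (+-congˡ (-‿inverseˡ z)) (+-identityʳ 1#))) ⟩
    1# * t               ≈⟨ *-identityˡ t ⟩
    t                    ∎

  geometric-sum : ∀ z n → (1# - z) * geometric z n + z ^ n ≈ 1#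
  geometric-sum z zero    = trans (+-congʳ (zeroʳ _)) (+-identityˡ 1#)
  geometric-sum z (suc n) = begin
    (1# - z) * (1# + z * t) + z * z ^ n
      ≈⟨ +-congʳ (trans (distribˡ _ 1# (z * t)) (+-cong (*-identityʳ _) (x∙yz≈y∙xz (1# - z) z t))) ⟩
    ((1# - z) + z * ((1# - z) * t)) + z * z ^ n
      ≈⟨ trans (+-assoc _ _ _) (+-congˡ (sym (distribˡ z _ _))) ⟩
    (1# - z) + z * ((1# - z) * t + z ^ n)
      ≈⟨ +-congˡ (trans (*-congˡ (geometric-sum z n)) (*-identityʳ z)) ⟩
    (1# - z) + z
      ≈⟨ trans (+-assoc 1# (- z) z) (trans (+-congˡ (-‿inverseˡ z)) (+-identityʳ 1#)) ⟩
    1# ∎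
    where
    t = geometric z n
    open import Algebra.Properties.CommutativeSemigroup *-commutativeSemigroup using (x∙yz≈y∙xz)

  deficit : Carrier → ℕ → Carrier
  deficit z zero    = 0#
  deficit z (suc n) = deficit z n + geometric z n

  geometric-deficit : ∀ z n → (1# - z) * deficit z n + geometric z n ≈ n × 1#
  geometric-deficit z zero    = trans (+-identityʳ _) (zeroʳ _)
  geometric-deficit z (suc n) = begin
    (1# - z) * (d + t) + (1# + z * t)          ≈⟨ x∙yz≈y∙xz _ 1# (z * t) ⟩
    1# + ((1# - z) * (d + t) + z * t)          ≈⟨ +-congˡ (+-congʳ (distribˡ _ d t)) ⟩
    1# + (((1# - z) * d + (1# - z) * t) + z * t) ≈⟨ +-congˡ (+-assoc _ _ _) ⟩
    1# + ((1# - z) * d + ((1# - z) * t + z * t)) ≈⟨ +-congˡ (+-congˡ (*-telescope z t)) ⟩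
    1# + ((1# - z) * d + t)                    ≈⟨ +-congˡ (geometric-deficit z n) ⟩
    1# + n × 1#                                ∎
    where
    d = deficit z n
    t = geometric z n
    open import Algebra.Properties.CommutativeSemigroup +-commutativeSemigroup using (x∙yz≈y∙xz)

  rootOfUnity-dec : CharacteristicZero K → ∀ {z} n → .{{NonZero n}} → z ^ n ≈ 1# → z # 1# ⊎ z ≈ 1#
  rootOfUnity-dec char0 {z} n zⁿ≈1 = decide (#-cotrans (char0 n) (geometric z n))
    where
    decide : n × 1# # geometric z n ⊎ geometric z n # 0# → z # 1# ⊎ z ≈ 1#
    decide (inj₁ p) = inj₁ (#-sym (-#0⇒# (x*y#0⇒x#0 (#-congʳ eq (#⇒-#0 p)))))
      where
      eq : n × 1# - geometric z n ≈ (1# - z) * deficit z n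
      eq = begin
        n × 1# - geometric z n ≈⟨ +-congʳ (geometric-deficit z n) ⟨
        ((1# - z) * deficit z n + geometric z n) - geometric z n ≈⟨ +-assoc _ _ _ ⟩
        (1# - z) * deficit z n + (geometric z n - geometric z n) ≈⟨ +-congˡ (-‿inverseʳ _) ⟩
        (1# - z) * deficit z n + 0#                              ≈⟨ +-identityʳ _ ⟩
        (1# - z) * deficit z n ∎
    decide (inj₂ p) = inj₂ (sym (x∙y⁻¹≈ε⇒x≈y 1# z (x*y≈0⇒y≈0 p
        (trans (*-comm _ _) (+-cancelʳ (z ^ n) _ 0#
          (trans (geometric-sum z n) (trans (sym zⁿ≈1) (sym (+-identityˡ _)))))))))

  powers-collide : ∀ {z i j} → z # 0# → i ℕ.< j → z ^ i ≈ z ^ j → ∃ λ n → NonZero n ∧ z ^ n ≈ 1#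
  powers-collide {z} {i} {j} z#0 i<j zⁱ≈zʲ = j ∸ i , ℕ.>-nonZero (ℕ.m<n⇒0<n∸m i<j) ,
    sym (cancelˡ (^#0 i) (begin
      z ^ i * 1#           ≈⟨ *-identityʳ _ ⟩
      z ^ i                ≈⟨ zⁱ≈zʲ ⟩
      z ^ j                ≈⟨ ^-congʳ z (ℕ.m+[n∸m]≡n (ℕ.<⇒≤ i<j)) ⟨
      z ^ (i ℕ.+ (j ∸ i))  ≈⟨ ^-homo-* z i (j ∸ i) ⟩
      z ^ i * z ^ (j ∸ i)  ∎))
    where
    ^#0 : ∀ m → z ^ m # 0#
    ^#0 zero    = 1#0
    ^#0 (suc m) = x#0y#0→xy#0 z#0 (^#0 m)

  sum-cong : ∀ {n} {f g : Fin n → Carrier} → (∀ i → f i ≈ g i) → sum f ≈ sum g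
  sum-cong = sum-cong-≋

  sum-single : ∀ {n} (f : Fin n → Carrier) i → (∀ j → ¬ j ≡ i → f j ≈ 0#) → sum f ≈ f i
  sum-single {suc n} f zero f≈0 = trans (+-congˡ
    (trans (sum-cong λ j → f≈0 (suc j) λ ()) (sum-replicate-zero n))) (+-identityʳ _)
  sum-single {suc n} f (suc i) f≈0 = trans
    (+-cong (f≈0 zero λ ()) (sum-single (f ∘ suc) i λ j j≢i → f≈0 (suc j) (j≢i ∘ suc-injective)))
    (+-identityˡ _)

-- F is the finite field with q elements, listed by `elements`. The field K of
-- values of the characters is ℂ in the intended application; it is kept abstract
-- to stop the arithmetic of ℂ from unfolding.
module Characters
  {k k₁ k₂} (K : HeytingField k k₁ k₂) (char0 : CharacteristicZero K)
  {c ℓ₁ ℓ₂} (F : HeytingField c ℓ₁ ℓ₂) {q : ℕ}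
  (elements : Enumeration (CommutativeRing.setoid (commutativeRing F)) q)
  where

  open FieldNotation K
  open FieldLemmas K
  module F where
    open FieldNotation F public
    open FieldLemmas F public
  private
    module E = Inverse elements

  ∑F : (F.Carrier → Carrier) → Carrier
  ∑F f = ∑[ i < q ] f (E.to i)

  infix 4 _≟_
  _≟_ : ∀ x y → Dec (x F.≈ y)
  x ≟ y = map′ injective E.from-cong (E.from x Fin.≟ E.from y)
    where
    injective : E.from x ≡ E.from y → x F.≈ y
    injective eq = F.trans (F.sym (E.inverseˡ ≡.refl)) (E.inverseˡ eq)

  -- Total, with 0 ⁻¹ ≈ 0.
  infix 9 _⁻¹
  _⁻¹ : F.Carrier → F.Carrier
  x ⁻¹ with any? (λ i → (x F.* E.to i) ≟ F.1#)
  ... | yes (i , _) = E.to i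
  ... | no _        = F.0#

  ⁻¹-inverseʳ : ∀ {x} → ¬ x F.≈ F.0# → x F.* x ⁻¹ F.≈ F.1#
  ⁻¹-inverseʳ {x} x≉0 with any? (λ i → (x F.* E.to i) ≟ F.1#)
  ... | yes (_ , eq) = eq
  ... | no none = contradiction (proj₁ (F.tight x F.0#) λ x#0 →
        none (E.from (F.inverse x#0) ,
              F.trans (F.*-congˡ (E.inverseˡ ≡.refl)) (F.*-inverseʳ x#0))) x≉0

  ≉0⇒#0 : ∀ {x} → ¬ x F.≈ F.0# → x F.# F.0#
  ≉0⇒#0 x≉0 = F.rightInvertible⇒#0 (⁻¹-inverseʳ x≉0)

  0⁻¹≈0 : ∀ {x} → x F.≈ F.0# → x ⁻¹ F.≈ F.0#
  0⁻¹≈0 {x} x≈0 with any? (λ i → (x F.* E.to i) ≟ F.1#)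
  ... | yes (_ , eq) = contradiction F.1#0
        (F.#-irrefl (F.trans (F.sym eq) (F.trans (F.*-congʳ x≈0) (F.zeroˡ _))))
  ... | no _ = F.refl

  0≉1 : ¬ F.1# F.≈ F.0#
  0≉1 eq = F.#-irrefl eq F.1#0

  ⁻¹-unique : ∀ {x y} → x F.* y F.≈ F.1# → y F.≈ x ⁻¹
  ⁻¹-unique {x} {y} xy≈1 = F.cancelˡ (F.rightInvertible⇒#0 xy≈1)
    (F.trans xy≈1 (F.sym (⁻¹-inverseʳ (λ x≈0 →
      0≉1 (F.trans (F.sym xy≈1) (F.trans (F.*-congʳ x≈0) (F.zeroˡ y)))))))

  ⁻¹-cong : ∀ {x y} → x F.≈ y → x ⁻¹ F.≈ y ⁻¹
  ⁻¹-cong {x} {y} x≈y with x ≟ F.0#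
  ... | yes x≈0 = F.trans (0⁻¹≈0 x≈0) (F.sym (0⁻¹≈0 (F.trans (F.sym x≈y) x≈0)))
  ... | no x≉0  = ⁻¹-unique (F.trans (F.*-congʳ (F.sym x≈y)) (⁻¹-inverseʳ x≉0))

  *≈0 : ∀ {x y} → x F.* y F.≈ F.0# → x F.≈ F.0# ⊎ y F.≈ F.0#
  *≈0 {x} {y} xy≈0 with x ≟ F.0#
  ... | yes x≈0 = inj₁ x≈0
  ... | no x≉0  = inj₂ (F.x*y≈0⇒y≈0 (≉0⇒#0 x≉0) xy≈0)

  ⁻¹-homo-* : ∀ x y → (x F.* y) ⁻¹ F.≈ x ⁻¹ F.* y ⁻¹
  ⁻¹-homo-* x y with x ≟ F.0# | y ≟ F.0#
  ... | yes x≈0 | _ = F.trans (0⁻¹≈0 (F.trans (F.*-congʳ x≈0) (F.zeroˡ y)))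
                        (F.sym (F.trans (F.*-congʳ (0⁻¹≈0 x≈0)) (F.zeroˡ _)))
  ... | no _ | yes y≈0 = F.trans (0⁻¹≈0 (F.trans (F.*-congˡ y≈0) (F.zeroʳ x)))
                        (F.sym (F.trans (F.*-congˡ (0⁻¹≈0 y≈0)) (F.zeroʳ _)))
  ... | no x≉0 | no y≉0 = F.sym (⁻¹-unique (F.trans (interchange x y (x ⁻¹) (y ⁻¹))
        (F.trans (F.*-cong (⁻¹-inverseʳ x≉0) (⁻¹-inverseʳ y≉0)) (F.*-identityˡ F.1#))))
    where open import Algebra.Properties.CommutativeSemigroup F.*-commutativeSemigroup using (interchange)

  -- A character of the unit group of F together with its extension by 0 to F:
  -- restriction to the units (whose values are then automatically units) is a
  -- bijection onto the homomorphisms from F \ {0} to K \ {0}.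
  record MultiplicativeCharacter : Set (k ⊔ k₁ ⊔ c ⊔ ℓ₁) where
    field
      ⟦_⟧                 : F.Carrier → Carrier
      isMonoidHomomorphism : IsMonoidHomomorphism
                               (Monoid.rawMonoid F.*-monoid) (Monoid.rawMonoid *-monoid) ⟦_⟧
      0#-homo             : ⟦ F.0# ⟧ ≈ 0#

    open IsMonoidHomomorphism isMonoidHomomorphism public
      using () renaming (⟦⟧-cong to cong; homo to *-homo; ε-homo to 1#-homo)

  record AdditiveCharacter : Set (k ⊔ k₁ ⊔ c ⊔ ℓ₁) where
    field
      ⟦_⟧                 : F.Carrier → Carrier
      isMonoidHomomorphism : IsMonoidHomomorphism
                               (Monoid.rawMonoid F.+-monoid) (Monoid.rawMonoid *-monoid) ⟦_⟧

    open IsMonoidHomomorphism isMonoidHomomorphism public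
      using () renaming (⟦⟧-cong to cong; homo to +-homo; ε-homo to 0#-homo)

  NonTrivial : AdditiveCharacter → Set (c ⊔ k₁)
  NonTrivial θ = ¬ (∀ x → AdditiveCharacter.⟦ θ ⟧ x ≈ 1#)

  private
    module A = AdditiveCharacter
    module M = MultiplicativeCharacter

  monoidHomomorphism : ∀ {m ℓ} (M : Monoid m ℓ) (f : Monoid.Carrier M → Carrier) →
    (∀ {x y} → Monoid._≈_ M x y → f x ≈ f y) → (∀ x y → f (Monoid._∙_ M x y) ≈ f x * f y) →
    f (Monoid.ε M) ≈ 1# → IsMonoidHomomorphism (Monoid.rawMonoid M) (Monoid.rawMonoid *-monoid) f
  monoidHomomorphism M f f-cong f-homo f-ε = record
    { isMagmaHomomorphism = record { isRelHomomorphism = record { cong = f-cong } ; homo = f-homo }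
    ; ε-homo = f-ε
    }

  ε : MultiplicativeCharacter
  ε = record
    { ⟦_⟧ = ε⟦_⟧
    ; isMonoidHomomorphism = monoidHomomorphism F.*-monoid ε⟦_⟧ ε-cong ε-* (ε-unit 0≉1)
    ; 0#-homo = ε-zero F.refl
    }
    where
    ε⟦_⟧ : F.Carrier → Carrier
    ε⟦ x ⟧ with x ≟ F.0#
    ... | yes _ = 0#
    ... | no _  = 1#
    ε-zero : ∀ {x} → x F.≈ F.0# → ε⟦ x ⟧ ≈ 0#
    ε-zero {x} x≈0 with x ≟ F.0#
    ... | yes _  = refl
    ... | no x≉0 = contradiction x≈0 x≉0
    ε-unit : ∀ {x} → ¬ x F.≈ F.0# → ε⟦ x ⟧ ≈ 1#
    ε-unit {x} x≉0 with x ≟ F.0#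
    ... | yes x≈0 = contradiction x≈0 x≉0
    ... | no _    = refl
    ε-cong : ∀ {x y} → x F.≈ y → ε⟦ x ⟧ ≈ ε⟦ y ⟧
    ε-cong {x} {y} x≈y = [ (λ x≈0 → trans (ε-zero x≈0) (sym (ε-zero (F.trans (F.sym x≈y) x≈0))))
                         , (λ x≉0 → trans (ε-unit x≉0) (sym (ε-unit (x≉0 ∘ F.trans x≈y)))) ]′ (toSum (x ≟ F.0#))
    ε-* : ∀ x y → ε⟦ x F.* y ⟧ ≈ ε⟦ x ⟧ * ε⟦ y ⟧
    ε-* x y = decide (x ≟ F.0#) (y ≟ F.0#)
      where
      decide : Dec (x F.≈ F.0#) → Dec (y F.≈ F.0#) → ε⟦ x F.* y ⟧ ≈ ε⟦ x ⟧ * ε⟦ y ⟧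
      decide (yes x≈0) _ = trans (ε-zero (F.trans (F.*-congʳ x≈0) (F.zeroˡ y)))
        (sym (trans (*-congʳ (ε-zero x≈0)) (zeroˡ _)))
      decide (no _) (yes y≈0) = trans (ε-zero (F.trans (F.*-congˡ y≈0) (F.zeroʳ x)))
        (sym (trans (*-congˡ (ε-zero y≈0)) (zeroʳ _)))
      decide (no x≉0) (no y≉0) = trans (ε-unit ([ x≉0 , y≉0 ]′ ∘ *≈0))
        (sym (trans (*-cong (ε-unit x≉0) (ε-unit y≉0)) (*-identityˡ 1#)))

  ε≉0 : ∀ {x} → ¬ x F.≈ F.0# → M.⟦ ε ⟧ x ≈ 1#
  ε≉0 {x} x≉0 with x ≟ F.0#
  ... | yes x≈0 = contradiction x≈0 x≉0
  ... | no _    = refl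

  infixl 7 _∙_
  _∙_ : MultiplicativeCharacter → MultiplicativeCharacter → MultiplicativeCharacter
  χ ∙ ψ = record
    { ⟦_⟧ = λ x → M.⟦ χ ⟧ x * M.⟦ ψ ⟧ x
    ; isMonoidHomomorphism = monoidHomomorphism F.*-monoid _
        (λ x≈y → *-cong (M.cong χ x≈y) (M.cong ψ x≈y))
        (λ x y → trans (*-cong (M.*-homo χ x y) (M.*-homo ψ x y)) (interchange _ _ _ _))
        (trans (*-cong (M.1#-homo χ) (M.1#-homo ψ)) (*-identityˡ 1#))
    ; 0#-homo = trans (*-congʳ (M.0#-homo χ)) (zeroˡ _)
    }
    where open import Algebra.Properties.CommutativeSemigroup *-commutativeSemigroup using (interchange)

  infix 9 _̅
  _̅ : MultiplicativeCharacter → MultiplicativeCharacter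
  χ ̅ = record
    { ⟦_⟧ = λ x → M.⟦ χ ⟧ (x ⁻¹)
    ; isMonoidHomomorphism = monoidHomomorphism F.*-monoid _
        (M.cong χ ∘ ⁻¹-cong)
        (λ x y → trans (M.cong χ (⁻¹-homo-* x y)) (M.*-homo χ _ _))
        (trans (M.cong χ (F.sym (⁻¹-unique (F.*-identityˡ F.1#)))) (M.1#-homo χ))
    ; 0#-homo = trans (M.cong χ (0⁻¹≈0 F.refl)) (M.0#-homo χ)
    }

  χ-inverse : ∀ χ {x} → ¬ x F.≈ F.0# → M.⟦ χ ⟧ (x ⁻¹) * M.⟦ χ ⟧ x ≈ 1#
  χ-inverse χ {x} x≉0 = trans (sym (M.*-homo χ _ _))
    (trans (M.cong χ (F.trans (F.*-comm _ _) (⁻¹-inverseʳ x≉0))) (M.1#-homo χ))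

  characterGroup : AbelianGroup (k ⊔ k₁ ⊔ c ⊔ ℓ₁) (c ⊔ k₁)
  characterGroup = record
    { Carrier = MultiplicativeCharacter
    ; _≈_ = λ χ ψ → ∀ x → M.⟦ χ ⟧ x ≈ M.⟦ ψ ⟧ x
    ; _∙_ = _∙_
    ; ε   = ε
    ; _⁻¹ = _̅
    ; isAbelianGroup = record
      { isGroup = record
        { isMonoid = record
          { isSemigroup = record
            { isMagma = record
              { isEquivalence = record
                { refl  = λ _ → refl
                ; sym   = λ p x → sym (p x)
                ; trans = λ p r x → trans (p x) (r x)
                }
              ; ∙-cong = λ p r x → *-cong (p x) (r x)
              }
            ; assoc = λ _ _ _ x → *-assoc _ _ _
            }
          ; identity = identityˡ , λ χ x → trans (*-comm _ _) (identityˡ χ x)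
          }
        ; inverse = inverseˡ , λ χ x → trans (*-comm _ _) (inverseˡ χ x)
        ; ⁻¹-cong = λ p x → p (x ⁻¹)
        }
      ; comm = λ _ _ x → *-comm _ _
      }
    }
    where
    at-zero : ∀ χ {x} → x F.≈ F.0# → M.⟦ χ ⟧ x ≈ 0#
    at-zero χ x≈0 = trans (M.cong χ x≈0) (M.0#-homo χ)
    identityˡ : ∀ χ x → M.⟦ ε ⟧ x * M.⟦ χ ⟧ x ≈ M.⟦ χ ⟧ x
    identityˡ χ x = [ (λ x≈0 → trans (*-congˡ (at-zero χ x≈0)) (trans (zeroʳ _) (sym (at-zero χ x≈0))))
                    , (λ x≉0 → trans (*-congʳ (ε≉0 x≉0)) (*-identityˡ _)) ]′ (toSum (x ≟ F.0#))
    inverseˡ : ∀ χ x → M.⟦ χ ̅ ⟧ x * M.⟦ χ ⟧ x ≈ M.⟦ ε ⟧ x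
    inverseˡ χ x = [ (λ x≈0 → trans (*-congˡ (at-zero χ x≈0)) (trans (zeroʳ _) (sym (at-zero ε x≈0))))
                   , (λ x≉0 → trans (χ-inverse χ x≉0) (sym (ε≉0 x≉0))) ]′ (toSum (x ≟ F.0#))

  open import Algebra.Definitions.RawMonoid (AbelianGroup.rawMonoid characterGroup) public
    using () renaming (_×_ to power)

  private
    E-to-from : ∀ x → E.to (E.from x) F.≈ x
    E-to-from x = E.inverseˡ ≡.refl

  ∑F-cong : ∀ f g → (∀ x → f x ≈ g x) → ∑F f ≈ ∑F g
  ∑F-cong f g f≈g = sum-cong {q} {f ∘ E.to} {g ∘ E.to} (f≈g ∘ E.to)

  ∑F-reindex : ∀ f → (∀ {x y} → x F.≈ y → f x ≈ f y) →
    (σ τ : F.Carrier → F.Carrier) → (∀ {x y} → x F.≈ y → σ x F.≈ σ y) → (∀ {x y} → x F.≈ y → τ x F.≈ τ y) →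
    (∀ x → σ (τ x) F.≈ x) → (∀ x → τ (σ x) F.≈ x) → ∑F f ≈ ∑F (f ∘ σ)
  ∑F-reindex f f-cong σ τ σ-cong τ-cong στ τσ = trans
    (∑-permute (f ∘ E.to) (permutation (E.from ∘ σ ∘ E.to) (E.from ∘ τ ∘ E.to)
      (λ i → E.inverseʳ (F.trans (σ-cong (E-to-from _)) (στ (E.to i))))
      (λ i → E.inverseʳ (F.trans (τ-cong (E-to-from _)) (τσ (E.to i))))))
    (sum-cong {q} {λ i → f (E.to (E.from (σ (E.to i))))} {f ∘ σ ∘ E.to} λ i → f-cong (E-to-from _))

  ∑F-single : ∀ f → (∀ {x y} → x F.≈ y → f x ≈ f y) →
    ∀ a → (∀ x → ¬ x F.≈ a → f x ≈ 0#) → ∑F f ≈ f a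
  ∑F-single f f-cong a f≈0 = trans
    (sum-single (f ∘ E.to) (E.from a) λ j j≢ →
      f≈0 (E.to j) λ eq → j≢ (≡.sym (E.inverseʳ (F.sym eq))))
    (f-cong (E-to-from a))

  ∑F-scale : ∀ f → (∀ {x y} → x F.≈ y → f x ≈ f y) →
             ∀ {s} → ¬ s F.≈ F.0# → ∑F f ≈ ∑F λ x → f (s F.* x)
  ∑F-scale f f-cong {s} s≉0 = ∑F-reindex f f-cong (s F.*_) (s ⁻¹ F.*_) F.*-congˡ F.*-congˡ
    (λ x → cancel (⁻¹-inverseʳ s≉0) x)
    (λ x → cancel (F.trans (F.*-comm _ _) (⁻¹-inverseʳ s≉0)) x)
    where
    cancel : ∀ {u v} → u F.* v F.≈ F.1# → ∀ x → u F.* (v F.* x) F.≈ x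
    cancel uv≈1 x = F.trans (F.sym (F.*-assoc _ _ x)) (F.trans (F.*-congʳ uv≈1) (F.*-identityˡ x))

  rootOfUnity : ∀ {z} → z # 0# → (s : ℕ → F.Carrier) (φ : F.Carrier → Carrier) →
    (∀ {x y} → x F.≈ y → φ x ≈ φ y) → (∀ i → φ (s i) ≈ z ^ i) → z # 1# ⊎ z ≈ 1#
  rootOfUnity {z} z#0 s φ φ-cong φs =
    let i , j , i<j , eq = pigeonhole (ℕ.n<1+n q) (λ i → E.from (s (toℕ i)))
        sᵢ≈sⱼ = F.trans (F.sym (E-to-from (s (toℕ i)))) (E.inverseˡ eq)
        n , n≢0 , zⁿ≈1 = powers-collide {z} {toℕ i} {toℕ j} z#0 i<j
          (trans (sym (φs (toℕ i))) (trans (φ-cong sᵢ≈sⱼ) (φs (toℕ j)))) in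
    rootOfUnity-dec char0 n {{n≢0}} zⁿ≈1

  θ#0 : ∀ θ x → A.⟦ θ ⟧ x # 0#
  θ#0 θ x = rightInvertible⇒#0 (trans (sym (A.+-homo θ x (F.- x)))
    (trans (A.cong θ (F.-‿inverseʳ x)) (A.0#-homo θ)))

  χ#0 : ∀ χ {x} → ¬ x F.≈ F.0# → M.⟦ χ ⟧ x # 0#
  χ#0 χ x≉0 = rightInvertible⇒#0 (trans (*-comm _ _) (χ-inverse χ x≉0))

  χ-at-0 : ∀ χ {x} → x F.≈ F.0# → M.⟦ χ ⟧ x ≈ 0#
  χ-at-0 χ x≈0 = trans (M.cong χ x≈0) (M.0#-homo χ)

  nonTrivial-witness : ∀ θ → NonTrivial θ → ∃ λ a → A.⟦ θ ⟧ a # 1#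
  nonTrivial-witness θ θ≉1 = [ (λ (i , p) → E.to i , p) , (λ all → contradiction
      (λ x → trans (A.cong θ (F.sym (E-to-from x))) (all (E.from x))) θ≉1) ]′
    (decide-all λ i → rootOfUnity (θ#0 θ (E.to i)) (F._× E.to i) A.⟦ θ ⟧ (A.cong θ) (multiples (E.to i)))
    where
    multiples : ∀ x i → A.⟦ θ ⟧ (i F.× x) ≈ A.⟦ θ ⟧ x ^ i
    multiples x zero    = A.0#-homo θ
    multiples x (suc i) = trans (A.+-homo θ x (i F.× x)) (*-congˡ (multiples x i))

  trivial? : ∀ χ → (∃ λ a → ¬ a F.≈ F.0# ∧ M.⟦ χ ⟧ a # 1#) ⊎ (∀ x → M.⟦ χ ⟧ x ≈ M.⟦ ε ⟧ x)
  trivial? χ = Sum.map (λ (i , p) → E.to i , p)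
    (λ all x → trans (M.cong χ (F.sym (E-to-from x))) (trans (all (E.from x)) (M.cong ε (E-to-from x))))
    (decide-all λ i → decide (E.to i) (E.to i ≟ F.0#))
    where
    powers : ∀ x i → M.⟦ χ ⟧ (x F.^ i) ≈ M.⟦ χ ⟧ x ^ i
    powers x zero    = M.1#-homo χ
    powers x (suc i) = trans (M.*-homo χ x (x F.^ i)) (*-congˡ (powers x i))
    decide : ∀ x → Dec (x F.≈ F.0#) →
             (¬ x F.≈ F.0# ∧ M.⟦ χ ⟧ x # 1#) ⊎ M.⟦ χ ⟧ x ≈ M.⟦ ε ⟧ x
    decide x (yes x≈0) = inj₂ (trans (χ-at-0 χ x≈0) (sym (χ-at-0 ε x≈0)))
    decide x (no x≉0)  = Sum.map (x≉0 ,_) (λ χx≈1 → trans χx≈1 (sym (ε≉0 x≉0)))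
      (rootOfUnity (χ#0 χ x≉0) (x F.^_) M.⟦ χ ⟧ (M.cong χ) (powers x))

  ∑θ≈0 : ∀ θ → NonTrivial θ → ∑F A.⟦ θ ⟧ ≈ 0#
  ∑θ≈0 θ θ≉1 = let a , θa#1 = nonTrivial-witness θ θ≉1 in
    fixed⇒0 θa#1 (trans (*-distribˡ-sum _ (A.⟦ θ ⟧ ∘ E.to)) (trans
      (∑F-cong (λ x → A.⟦ θ ⟧ a * A.⟦ θ ⟧ x) (λ x → A.⟦ θ ⟧ (a F.+ x)) (λ x → sym (A.+-homo θ a x)))
      (sym (∑F-reindex A.⟦ θ ⟧ (A.cong θ) (a F.+_) (F.- a F.+_) F.+-congˡ F.+-congˡ
        (λ x → cancel (F.-‿inverseʳ a) x) (λ x → cancel (F.-‿inverseˡ a) x)))))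
    where
    cancel : ∀ {u v} → u F.+ v F.≈ F.0# → ∀ x → u F.+ (v F.+ x) F.≈ x
    cancel uv≈0 x = F.trans (F.sym (F.+-assoc _ _ x)) (F.trans (F.+-congʳ uv≈0) (F.+-identityˡ x))

  ∑χ≈0 : ∀ χ {a} → ¬ a F.≈ F.0# → M.⟦ χ ⟧ a # 1# → ∑F M.⟦ χ ⟧ ≈ 0#
  ∑χ≈0 χ {a} a≉0 χa#1 = fixed⇒0 χa#1 (trans (*-distribˡ-sum _ (M.⟦ χ ⟧ ∘ E.to)) (trans
    (∑F-cong (λ x → M.⟦ χ ⟧ a * M.⟦ χ ⟧ x) (λ x → M.⟦ χ ⟧ (a F.* x)) (λ x → sym (M.*-homo χ a x)))
    (sym (∑F-scale M.⟦ χ ⟧ (M.cong χ) a≉0))))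

  gaussSum : AdditiveCharacter → MultiplicativeCharacter → Carrier
  gaussSum θ χ = ∑F λ x → M.⟦ χ ⟧ x * A.⟦ θ ⟧ x

  module _ (θ : AdditiveCharacter) (θ≉1 : NonTrivial θ) where
    open ≈-Reasoning setoid
    open import Algebra.Properties.CommutativeSemigroup *-commutativeSemigroup using (interchange; x∙yz≈y∙xz)

    private
      g : MultiplicativeCharacter → Carrier
      g = gaussSum θ
      θ[_] : F.Carrier → Carrier
      θ[_] = A.⟦ θ ⟧

    q#0 : q × 1# # 0#
    q#0 = char0 q {{Fin.nonZeroIndex (E.from F.0#)}}

    gε#0 : g ε # 0#
    gε#0 = #-congʳ (sym (trans (sym (+-identityʳ _)) (trans (+-congˡ (sym (-‿inverseʳ 1#)))
        (trans (sym (+-assoc _ _ _)) (trans (+-congʳ g+1≈0) (+-identityˡ _)))))) -1#0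
      where
      δ : F.Carrier → Carrier
      δ x = 1# - M.⟦ ε ⟧ x
      δ-cong : ∀ {x y} → x F.≈ y → δ x ≈ δ y
      δ-cong x≈y = +-congˡ (-‿cong (M.cong ε x≈y))
      δ-0 : ∀ {x} → x F.≈ F.0# → δ x ≈ 1#
      δ-0 x≈0 = trans (+-congˡ (-‿cong (χ-at-0 ε x≈0))) (x-0≈x 1#)
      δ-≉0 : ∀ x → ¬ x F.≈ F.0# → δ x ≈ 0#
      δ-≉0 x x≉0 = trans (+-congˡ (-‿cong (ε≉0 x≉0))) (-‿inverseʳ 1#)
      split : ∀ x → M.⟦ ε ⟧ x * θ[ x ] + δ x ≈ θ[ x ]
      split x = [ (λ x≈0 → trans (+-cong (trans (*-congʳ (χ-at-0 ε x≈0)) (zeroˡ _)) (δ-0 x≈0))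
                              (trans (+-identityˡ 1#) (sym (trans (A.cong θ x≈0) (A.0#-homo θ)))))
                , (λ x≉0 → trans (+-cong (trans (*-congʳ (ε≉0 x≉0)) (*-identityˡ _)) (δ-≉0 x x≉0))
                              (+-identityʳ _)) ]′ (toSum (x ≟ F.0#))
      g+1≈0 : g ε + 1# ≈ 0#
      g+1≈0 = begin
        g ε + 1#      ≈⟨ +-congˡ (trans (∑F-single δ δ-cong F.0# δ-≉0) (δ-0 F.refl)) ⟨
        g ε + ∑F δ    ≈⟨ ∑-distrib-+ {q} (λ i → M.⟦ ε ⟧ (E.to i) * θ[ E.to i ]) (δ ∘ E.to) ⟨
        ∑F (λ x → M.⟦ ε ⟧ x * θ[ x ] + δ x) ≈⟨ ∑F-cong (λ x → M.⟦ ε ⟧ x * θ[ x ] + δ x) θ[_] split ⟩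
        ∑F θ[_]       ≈⟨ ∑θ≈0 θ θ≉1 ⟩
        0#            ∎

    module _ (χ : MultiplicativeCharacter) {a} (a≉0 : ¬ a F.≈ F.0#) (χa#1 : M.⟦ χ ⟧ a # 1#) where
      private
        χ[_] : F.Carrier → Carrier
        χ[_] = M.⟦ χ ⟧
        J : F.Carrier → Carrier
        J s = ∑F λ y → θ[ s F.* y ]

      J-0 : ∀ {s} → s F.≈ F.0# → J s ≈ q × 1#
      J-0 {s} s≈0 = trans (∑F-cong (λ y → θ[ s F.* y ]) (λ _ → 1#) λ y → trans (A.cong θ (F.trans (F.*-congʳ s≈0) (F.zeroˡ y))) (A.0#-homo θ))
        (sum-replicate q)

      J-≉0 : ∀ {s} → ¬ s F.≈ F.0# → J s ≈ 0#
      J-≉0 s≉0 = trans (sym (∑F-scale θ[_] (A.cong θ) s≉0)) (∑θ≈0 θ θ≉1)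

      summand : F.Carrier → F.Carrier → Carrier
      summand x y = (χ[ x ] * θ[ x ]) * (χ[ y ⁻¹ ] * θ[ y ])

      inner : ∀ y → ∑F (λ x → summand x y) ≈ ∑F λ t → χ[ t ] * θ[ (t F.+ F.1#) F.* y ]
      inner y = [ at-0 , away ]′ (toSum (y ≟ F.0#))
        where
        at-0 : y F.≈ F.0# → _
        at-0 y≈0 = trans
          (trans (∑F-cong (λ x → summand x y) (λ _ → 0#) λ x → trans (*-congˡ (trans (*-congʳ (χ-at-0 χ (0⁻¹≈0 y≈0))) (zeroˡ _))) (zeroʳ _))
            (sum-replicate-zero q))
          (sym (trans (∑F-cong (λ t → χ[ t ] * θ[ (t F.+ F.1#) F.* y ]) χ[_] λ t → trans
              (*-congˡ (trans (A.cong θ (F.trans (F.*-congˡ y≈0) (F.zeroʳ _))) (A.0#-homo θ))) (*-identityʳ _))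
            (∑χ≈0 χ a≉0 χa#1)))
        away : ¬ y F.≈ F.0# → _
        away y≉0 = trans
          (∑F-scale (λ x → summand x y) (λ p → *-congʳ (*-cong (M.cong χ p) (A.cong θ p))) y≉0)
          (∑F-cong (λ t → summand (y F.* t) y) (λ t → χ[ t ] * θ[ (t F.+ F.1#) F.* y ]) λ t → begin
            (χ[ y F.* t ] * θ[ y F.* t ]) * (χ[ y ⁻¹ ] * θ[ y ])  ≈⟨ interchange _ _ _ _ ⟩
            (χ[ y F.* t ] * χ[ y ⁻¹ ]) * (θ[ y F.* t ] * θ[ y ])  ≈⟨ *-cong (χ-part t) (θ-part t) ⟩
            χ[ t ] * θ[ (t F.+ F.1#) F.* y ]                      ∎)
          where
          χ-part : ∀ t → χ[ y F.* t ] * χ[ y ⁻¹ ] ≈ χ[ t ]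
          χ-part t = begin
            χ[ y F.* t ] * χ[ y ⁻¹ ]          ≈⟨ trans (*-congʳ (M.*-homo χ y t)) (*-comm _ _) ⟩
            χ[ y ⁻¹ ] * (χ[ y ] * χ[ t ])     ≈⟨ *-assoc _ _ _ ⟨
            (χ[ y ⁻¹ ] * χ[ y ]) * χ[ t ]     ≈⟨ *-congʳ (χ-inverse χ y≉0) ⟩
            1# * χ[ t ]                       ≈⟨ *-identityˡ _ ⟩
            χ[ t ]                            ∎
          θ-part : ∀ t → θ[ y F.* t ] * θ[ y ] ≈ θ[ (t F.+ F.1#) F.* y ]
          θ-part t = trans (sym (A.+-homo θ _ _)) (A.cong θ (F.sym (F.trans (F.distribʳ y t F.1#)
            (F.+-cong (F.*-comm t y) (F.*-identityˡ y)))))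

      -1F : F.Carrier
      -1F = F.- F.1#

      gχ*gχ̅ : g χ * g (χ ̅) ≈ χ[ -1F ] * (q × 1#)
      gχ*gχ̅ = begin
        g χ * g (χ ̅)
          ≈⟨ *-distribˡ-sum (g χ) (λ j → χ[ E.to j ⁻¹ ] * θ[ E.to j ]) ⟩
        ∑F (λ y → g χ * (χ[ y ⁻¹ ] * θ[ y ]))
          ≈⟨ ∑F-cong (λ y → g χ * (χ[ y ⁻¹ ] * θ[ y ])) (λ y → ∑F λ x → summand x y) (λ y → *-distribʳ-sum (χ[ y ⁻¹ ] * θ[ y ]) (λ i → χ[ E.to i ] * θ[ E.to i ])) ⟩
        ∑F (λ y → ∑F λ x → summand x y)
          ≈⟨ ∑F-cong (λ y → ∑F λ x → summand x y) (λ y → ∑F λ t → χ[ t ] * θ[ (t F.+ F.1#) F.* y ]) inner ⟩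
        ∑F (λ y → ∑F λ t → χ[ t ] * θ[ (t F.+ F.1#) F.* y ])
          ≈⟨ ∑-comm {q} {q} (λ i j → χ[ E.to j ] * θ[ (E.to j F.+ F.1#) F.* E.to i ]) ⟩
        ∑F (λ t → ∑F λ y → χ[ t ] * θ[ (t F.+ F.1#) F.* y ])
          ≈⟨ ∑F-cong (λ t → χ[ t ] * J (t F.+ F.1#)) (λ t → ∑F λ y → χ[ t ] * θ[ (t F.+ F.1#) F.* y ]) (λ t → *-distribˡ-sum χ[ t ] (λ i → θ[ (t F.+ F.1#) F.* E.to i ])) ⟨
        ∑F (λ t → χ[ t ] * J (t F.+ F.1#))
          ≈⟨ ∑F-single (λ t → χ[ t ] * J (t F.+ F.1#)) (λ {u} {v} p → *-cong (M.cong χ p) (∑F-cong (λ y → θ[ (u F.+ F.1#) F.* y ]) (λ y → θ[ (v F.+ F.1#) F.* y ]) λ y → A.cong θ (F.*-congʳ (F.+-congʳ p)))) -1F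
               (λ t t≉-1 → trans (*-congˡ (J-≉0 λ t+1≈0 → t≉-1 (F-minus-unique t+1≈0))) (zeroʳ _)) ⟩
        χ[ -1F ] * J (-1F F.+ F.1#)
          ≈⟨ *-congˡ (J-0 (F.-‿inverseˡ F.1#)) ⟩
        χ[ -1F ] * (q × 1#) ∎
        where
        F-minus-unique : ∀ {t} → t F.+ F.1# F.≈ F.0# → t F.≈ -1F
        F-minus-unique {t} = inverseˡ-unique t F.1#
          where open import Algebra.Properties.Group F.+-group using (inverseˡ-unique)

      nonTrivial-gauss#0 : g χ # 0#
      nonTrivial-gauss#0 = x*y#0⇒x#0 (#-congʳ (sym gχ*gχ̅)
        (x#0y#0→xy#0 (χ#0 χ λ -1≈0 → 0≉1 (F.trans (F.sym (F.trans (F.+-congʳ -1≈0) (F.+-identityˡ F.1#))) (F.-‿inverseˡ F.1#))) q#0))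

    -- Gauss sums are non-zero, so dividing by them is legitimate.
    gaussSum#0 : ∀ χ → gaussSum θ χ # 0#
    gaussSum#0 χ = [ (λ (a , a≉0 , χa#1) → nonTrivial-gauss#0 χ a≉0 χa#1)
      , (λ χ≈ε → #-congʳ (∑F-cong (λ x → M.⟦ ε ⟧ x * θ[ x ]) (λ x → M.⟦ χ ⟧ x * θ[ x ]) λ x → *-congʳ (sym (χ≈ε x))) gε#0) ]′ (trivial? χ)

  q-1#0 : (q ∸ 1) × 1# # 0#
  q-1#0 = char0 (q ∸ 1) {{ℕ.≢-nonZero q∸1≢0}}
    where
    subsingleton : ∀ {m} → m ∸ 1 ≡ 0 → (i j : Fin m) → i ≡ j
    subsingleton {suc zero} _ zero zero = ≡.refl
    q∸1≢0 : ¬ q ∸ 1 ≡ 0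
    q∸1≢0 eq = 0≉1 (F.trans (F.sym (E-to-from F.1#))
      (E.inverseˡ (subsingleton eq (E.from F.1#) (E.from F.0#))))

  -- The sum over the character group runs along an enumeration `characters`
  -- of it; as that is a bijection, its choice (and that of N) is immaterial.
  hypergeometric : (θ : AdditiveCharacter) → NonTrivial θ →
    ∀ {N} → Enumeration (AbelianGroup.setoid characterGroup) N →
    ∀ {m} (A B : Fin m → MultiplicativeCharacter) → F.Carrier → Carrier
  hypergeometric θ θ≉1 {N} characters {m} A B z =
    ((- 1#) / ((q ∸ 1) × 1#) [ q-1#0 ]) *
    ∑[ j < N ]
      (let χ = Inverse.to characters j in
       product (λ i → (g (A i ∙ χ) / g (A i) [ g#0 (A i) ]) *
                      (g ((B i ∙ χ) ̅) / g (B i ̅) [ g#0 (B i ̅) ])) *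
       M.⟦ χ ⟧ (F.- F.1#) ^ m * M.⟦ χ ⟧ z)
    where
    g : MultiplicativeCharacter → Carrier
    g = gaussSum θ
    g#0 : ∀ χ → g χ # 0#
    g#0 = gaussSum#0 θ θ≉1

  HasOrder : MultiplicativeCharacter → ℕ → Set (c ⊔ k₁)
  HasOrder χ n = power n χ ≋ ε ∧ (∀ l → .{{NonZero l}} → power l χ ≋ ε → n ℕ.≤ l)
    where open AbelianGroup characterGroup using () renaming (_≈_ to _≋_)

  -- The family A i ∙ χˡ indexed by the pairs (l , i) with l < n and i < m,
  -- these pairs being listed through the bijection Fin (n * m) ↔ Fin n × Fin m.
  twists : MultiplicativeCharacter → (n : ℕ) → ∀ {m} →
           (Fin m → MultiplicativeCharacter) → Fin (n ℕ.* m) → MultiplicativeCharacter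
  twists χ n {m} A j = let l , i = remQuot {n} m j in A i ∙ power (toℕ l) χ

-- Replacing χ by χ ∙ χₙ permutes the twisted families, so it multiplies the sum over χ
-- by χₙ(z), and the sum vanishes as soon as χₙ(z) ≠ 1. This holds because the kernel of
-- χₙ consists of n-th powers: by induction on the prime factors of n it suffices to
-- treat a character of prime order r. There, let g lie outside the kernel and z inside,
-- and raise both to a power prime to r so that their orders become powers of r. As the
-- r-th roots of unity are cyclic, some gⁱ zʲ = 1 with r not dividing both i and j;
-- applying the character gives r ∣ i, and hence zʲ and z are r-th powers.
module Submission where

open import Defs
open import Algebra.Apartness.Bundles using (HeytingField)
open import Algebra.Bundles using (AbelianGroup; CommutativeRing)
open import Data.Fin.Base as Fin using (Fin; toℕ; _↑ˡ_; _↑ʳ_; remQuot; quotRem)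
open import Data.Fin.Permutation using (permutation)
open import Data.Fin.Properties as Fin using (any?; pigeonhole; remQuot-combine; splitAt-↑ʳ; toℕ<n; toℕ-injective)
open import Data.List.Base using (_∷_; [])
open import Data.List.Relation.Unary.All using (All; []; _∷_)
open import Data.Nat.Base as ℕ using (ℕ; zero; suc; NonZero; _/_)
open import Data.Nat.Coprimality using (Coprime; coprime-Bézout; prime⇒coprime)
open import Data.Nat.Divisibility using (_∣_; _∤_; _∣?_; divides; ∣m+n∣m⇒∣n; ∣m⇒∣m*n; ∣1⇒≡1)
open import Data.Nat.DivMod using (_%_; m≡m%n+[m/n]*n)
open import Data.Nat.GCD using (module Bézout)
open import Data.Nat.Induction using (<-rec)
import Data.Nat.ListAction as ℕ
open import Data.Nat.Primality using
  (Prime; prime⇒nonZero; prime⇒nonTrivial; prime⇒irreducible; euclidsLemma; productOfPrimes≢0)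
open import Data.Nat.Primality.Factorisation using (factorise; PrimeFactorisation)
import Data.Nat.Properties as ℕ
open import Data.Product.Base using (∃; _,_; proj₁; proj₂; map₂; swap) renaming (_×_ to _∧_)
open import Data.Sum.Base using (inj₁; inj₂; [_,_]′)
open import Function.Base using (id; _∘_)
open import Function.Bundles using (Inverse)
open import Relation.Binary.PropositionalEquality as ≡ using (_≡_)
import Relation.Binary.Reasoning.Setoid as ≈-Reasoning
open import Relation.Nullary using (Dec; ¬_; yes; no; contradiction)

-- Coprimality to a prime and the prime-to-r part of an integer.

prime∤1 : ∀ {r} → Prime r → r ∤ 1
prime∤1 r-prime r∣1 = ℕ.nonTrivial⇒≢1 {{prime⇒nonTrivial r-prime}} (∣1⇒≡1 r∣1)

prime∤⇒coprime : ∀ {r k} → Prime r → r ∤ k → Coprime k r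
prime∤⇒coprime r-prime r∤k (d∣k , d∣r) =
  [ id , (λ { ≡.refl → contradiction d∣k r∤k }) ]′ (prime⇒irreducible r-prime d∣r)

-- Raising to `s` an element killed by `n` yields one killed by a power of `r`.
split-prime-power : ∀ {r} → Prime r → ∀ n → .{{NonZero n}} → ∃ λ e → ∃ λ s → n ≡ r ℕ.^ e ℕ.* s ∧ r ∤ s
split-prime-power {r} r-prime n = <-rec P step n
  where
  P : ℕ → Set
  P n = .{{NonZero n}} → ∃ λ e → ∃ λ s → n ≡ r ℕ.^ e ℕ.* s ∧ r ∤ s
  step : ∀ n → (∀ {m} → m ℕ.< n → P m) → P n
  step n rec with r ∣? n
  ... | no r∤n = 0 , n , ≡.sym (ℕ.*-identityˡ n) , r∤n
  ... | yes (divides zero ≡.refl) = contradiction ≡.refl (ℕ.≢-nonZero⁻¹ 0)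
  ... | yes (divides t@(suc _) ≡.refl) =
    let e , s , t≡ , r∤s = rec (ℕ.m<m*n t r (ℕ.nonTrivial⇒n>1 r {{prime⇒nonTrivial r-prime}}))
    in suc e , s , ≡.trans (ℕ.*-comm t r) (≡.trans (≡.cong (r ℕ.*_) t≡) (≡.sym (ℕ.*-assoc r (r ℕ.^ e) s))) , r∤s

-- Powers, n-th powers and geometric sums in a field.

module FieldPowers {c ℓ₁ ℓ₂} (K : HeytingField c ℓ₁ ℓ₂) where
  open FieldNotation K
  open FieldLemmas K
  open import Algebra.Properties.CommutativeMonoid.Mult *-commutativeMonoid public using ()
    renaming (×-assocˡ to ^-assoc; ×-distrib-+ to ^-distrib-*; ×-congʳ to ^-cong; ×-congˡ to ^-congʳ; ×-homo-+ to ^-homo-+)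
  open import Algebra.Properties.Ring ring using (+-cancelʳ; x∙y⁻¹≈ε⇒x≈y)
  open ≈-Reasoning setoid

  1^n≈1 : ∀ n → 1# ^ n ≈ 1#
  1^n≈1 zero    = refl
  1^n≈1 (suc n) = trans (*-identityˡ _) (1^n≈1 n)

  ^-multiple : ∀ {x n} m → x ^ n ≈ 1# → x ^ (m ℕ.* n) ≈ 1#
  ^-multiple {x} {n} m xⁿ≈1 = trans (sym (^-assoc x m n)) (trans (^-cong m xⁿ≈1) (1^n≈1 m))

  ^-swap : ∀ x m n → (x ^ m) ^ n ≈ (x ^ n) ^ m
  ^-swap x m n = trans (^-assoc x n m) (trans (^-congʳ (ℕ.*-comm n m)) (sym (^-assoc x m n)))

  ^#0 : ∀ {x} n → x # 0# → x ^ n # 0#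
  ^#0 zero    x#0 = 1#0
  ^#0 (suc n) x#0 = x#0y#0→xy#0 x#0 (^#0 n x#0)

  ^#0⁻¹ : ∀ {x} n → .{{NonZero n}} → x ^ n # 0# → x # 0#
  ^#0⁻¹ (suc n) xⁿ#0 = x*y#0⇒x#0 xⁿ#0

  0^n≈0 : ∀ {x} n → .{{NonZero n}} → x ≈ 0# → x ^ n ≈ 0#
  0^n≈0 (suc n) x≈0 = trans (*-congʳ x≈0) (zeroˡ _)

  -- By Bézout, 1 is a combination of `m` and `n`; over the naturals there are two cases, according
  -- to which multiple exceeds the other by 1.
  coprime-orders⇒≈1 : ∀ {x m n} → Coprime m n → x ^ m ≈ 1# → x ^ n ≈ 1# → x ≈ 1#
  coprime-orders⇒≈1 {x} {m} {n} coprime xᵐ≈1 xⁿ≈1 with coprime-Bézout coprime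
  ... | Bézout.+- a b eq = begin
    x                    ≈⟨ trans (*-congˡ (^-multiple b xⁿ≈1)) (*-identityʳ x) ⟨
    x ^ (1 ℕ.+ b ℕ.* n)  ≈⟨ ^-congʳ eq ⟩
    x ^ (a ℕ.* m)        ≈⟨ ^-multiple a xᵐ≈1 ⟩
    1#                   ∎
  ... | Bézout.-+ a b eq = begin
    x                    ≈⟨ trans (*-congˡ (^-multiple a xᵐ≈1)) (*-identityʳ x) ⟨
    x ^ (1 ℕ.+ a ℕ.* m)  ≈⟨ ^-congʳ eq ⟩
    x ^ (b ℕ.* n)        ≈⟨ ^-multiple b xⁿ≈1 ⟩
    1#                   ∎

  IsPower : ℕ → Carrier → Set _
  IsPower n x = ∃ λ y → y ^ n ≈ x

  power-quotient : ∀ {x y z} n → y # 0# → x * y ^ n ≈ z ^ n → IsPower n x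
  power-quotient {x} {y} {z} n y#0 xyⁿ≈zⁿ = z * inverse y#0 , (begin
    (z * inverse y#0) ^ n            ≈⟨ ^-distrib-* z _ n ⟩
    z ^ n * inverse y#0 ^ n          ≈⟨ *-congʳ xyⁿ≈zⁿ ⟨
    (x * y ^ n) * inverse y#0 ^ n    ≈⟨ *-assoc x _ _ ⟩
    x * (y ^ n * inverse y#0 ^ n)    ≈⟨ *-congˡ (^-distrib-* y _ n) ⟨
    x * (y * inverse y#0) ^ n        ≈⟨ *-congˡ (trans (^-cong n (*-inverseʳ y#0)) (1^n≈1 n)) ⟩
    x * 1#                           ≈⟨ *-identityʳ x ⟩
    x                                ∎)

  -- Bézout exhibits `x` as a quotient of n-th powers, once `x ^ m` is replaced by `y ^ n`.
  coprime-power⇒power : ∀ {x m n} → .{{NonZero n}} → Coprime m n → x # 0# → IsPower n (x ^ m) → IsPower n x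
  coprime-power⇒power {x} {m} {n} coprime x#0 (y , yⁿ≈xᵐ) with coprime-Bézout coprime
  ... | Bézout.+- a b eq = power-quotient n (^#0 b x#0) (begin
    x * (x ^ b) ^ n      ≈⟨ *-congˡ (trans (^-swap x b n) (^-assoc x b n)) ⟩
    x ^ (1 ℕ.+ b ℕ.* n)  ≈⟨ ^-congʳ eq ⟩
    x ^ (a ℕ.* m)        ≈⟨ ^-assoc x a m ⟨
    (x ^ m) ^ a          ≈⟨ ^-cong a yⁿ≈xᵐ ⟨
    (y ^ n) ^ a          ≈⟨ ^-swap y n a ⟩
    (y ^ a) ^ n          ∎)
  -- The divisor is now a power of `y`, which is invertible because `y ^ n` equals the invertible
  -- `x ^ m`.
  ... | Bézout.-+ a b eq = power-quotient n (^#0 a (^#0⁻¹ n (#-congʳ (sym yⁿ≈xᵐ) (^#0 m x#0)))) (begin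
    x * (y ^ a) ^ n      ≈⟨ *-congˡ (^-swap y a n) ⟩
    x * (y ^ n) ^ a      ≈⟨ *-congˡ (^-cong a yⁿ≈xᵐ) ⟩
    x * (x ^ m) ^ a      ≈⟨ *-congˡ (^-assoc x a m) ⟩
    x ^ (1 ℕ.+ a ℕ.* m)  ≈⟨ ^-congʳ eq ⟩
    x ^ (b ℕ.* n)        ≈⟨ trans (^-swap x b n) (^-assoc x b n) ⟨
    (x ^ b) ^ n          ∎)

  sum-powers : ∀ x n → ∑[ j < n ] (x ^ toℕ j) ≈ geometric x n
  sum-powers x zero    = refl
  sum-powers x (suc n) = +-congˡ (trans (sym (*-distribˡ-sum {n} x (λ j → x ^ toℕ j))) (*-congˡ (sum-powers x n)))

  -- By the geometric series, (1 - x) times the sum is 1 - xⁿ = 0. Cancelling 1 - x takes apartness,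
  -- hence the last hypothesis, which a finite field satisfies.
  sum-powers≈0 : ∀ {x} n → ¬ x ≈ 1# → x ^ n ≈ 1# → (∀ y → ¬ y ≈ 0# → y # 0#) → ∑[ j < n ] (x ^ toℕ j) ≈ 0#
  sum-powers≈0 {x} n x≉1 xⁿ≈1 ≉⇒# = trans (sum-powers x n) (x*y≈0⇒y≈0
    (≉⇒# (1# - x) (x≉1 ∘ sym ∘ x∙y⁻¹≈ε⇒x≈y 1# x))
    (+-cancelʳ (x ^ n) _ 0# (trans (geometric-sum x n) (trans (sym xⁿ≈1) (sym (+-identityˡ _))))))

  -- Multiplicative relations between elements of r-power order.

  module PrimeRoots (_≟_ : ∀ x y → Dec (x ≈ y)) (≉⇒# : ∀ x → ¬ x ≈ 0# → x # 0#)
                    {r : ℕ} (r-prime : Prime r) (r≉0 : ¬ r × 1# ≈ 0#) where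

    -- If no product w uⁱ were 1, then each of their r geometric sums would vanish;
    -- but the double sum of (w uⁱ)ʲ collapses to the terms with j = 0, which give r.
    roots-cyclic : ∀ {u w} → ¬ u ≈ 1# → u ^ r ≈ 1# → w ^ r ≈ 1# → ∃ λ i → w * u ^ i ≈ 1#
    roots-cyclic {u} {w} u≉1 uʳ≈1 wʳ≈1 with any? {n = r} (λ i → (w * u ^ toℕ i) ≟ 1#)
    ... | yes (i , eq) = toℕ i , eq
    ... | no none = contradiction r≈0 r≉0
      where
      term : Fin r → Fin r → Carrier
      term i j = (w * u ^ toℕ i) ^ toℕ j
      rows : ∑[ i < r ] (∑[ j < r ] term i j) ≈ 0#
      rows = trans (sum-cong {r} {λ i → ∑[ j < r ] term i j} λ i →
          sum-powers≈0 r (λ eq → none (i , eq))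
            (trans (^-distrib-* w _ r) (trans (*-cong wʳ≈1 (trans (^-swap u (toℕ i) r) (trans (^-cong (toℕ i) uʳ≈1) (1^n≈1 (toℕ i)))))
              (*-identityˡ 1#))) ≉⇒#)
        (sum-replicate-zero r)
      column : ∀ j → ∑[ i < r ] term i j ≈ w ^ toℕ j * ∑[ i < r ] ((u ^ toℕ j) ^ toℕ i)
      column j = trans
        (sum-cong {r} {λ i → term i j} λ i → trans (^-distrib-* w _ (toℕ j)) (*-congˡ (^-swap u (toℕ i) (toℕ j))))
        (sym (*-distribˡ-sum {r} (w ^ toℕ j) (λ i → (u ^ toℕ j) ^ toℕ i)))
      column≈0 : ∀ j → ¬ toℕ j ≡ 0 → ∑[ i < r ] term i j ≈ 0#
      -- For 0 < j < r the exponent is prime to `r`, so uʲ = 1 together with uʳ = 1 would make `u`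
      -- trivial.
      column≈0 j j≢0 = trans (column j) (trans (*-congˡ (sum-powers≈0 r
          (λ uʲ≈1 → u≉1 (coprime-orders⇒≈1 (prime⇒coprime r-prime {{ℕ.≢-nonZero j≢0}} (toℕ<n j)) uʳ≈1 uʲ≈1))
          (trans (^-swap u (toℕ j) r) (trans (^-cong (toℕ j) uʳ≈1) (1^n≈1 (toℕ j)))) ≉⇒#))
        (zeroʳ _))
      columns : ∀ {j₀ : Fin r} → toℕ j₀ ≡ 0 → ∑[ j < r ] (∑[ i < r ] term i j) ≈ r × 1#
      columns {j₀} j₀≡0 = trans
        (sum-single (λ j → ∑[ i < r ] term i j) j₀ λ j j≢j₀ →
          column≈0 j (λ j≡0 → j≢j₀ (toℕ-injective (≡.trans j≡0 (≡.sym j₀≡0)))))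
        (trans (sum-cong {r} {λ i → term i j₀} {λ _ → 1#} λ i → ^-congʳ j₀≡0) (sum-replicate r))
      r≈0 : r × 1# ≈ 0#
      r≈0 = trans (sym (columns {Fin.fromℕ< {0} (ℕ.>-nonZero⁻¹ r {{prime⇒nonZero r-prime}})} (Fin.toℕ-fromℕ< _)))
        (trans (sym (∑-comm {r} {r} term)) rows)

    -- Relations with both exponents divisible by `r`, such as the empty one, say nothing about r-th
    -- powers and are excluded.
    Dependent : Carrier → Carrier → Set _
    Dependent u w = ∃ λ i → ∃ λ j → u ^ i * w ^ j ≈ 1# ∧ ¬ (r ∣ i ∧ r ∣ j)

    dependent-swap : ∀ {u w} → Dependent u w → Dependent w u
    dependent-swap (i , j , eq , r∤) = j , i , trans (*-comm _ _) eq , λ (r∣j , r∣i) → r∤ (r∣i , r∣j)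

    -- The exponents change by (i , j) ↦ (jm + i , j), which is invertible modulo `r`.
    dependent-shift : ∀ {u w} m → Dependent u (w * u ^ m) → Dependent u w
    dependent-shift {u} {w} m (i , j , eq , r∤) = j ℕ.* m ℕ.+ i , j , (begin
        u ^ (j ℕ.* m ℕ.+ i) * w ^ j          ≈⟨ *-congʳ (trans (^-homo-+ u (j ℕ.* m) i) (trans (*-comm _ _) (*-congˡ (sym (^-assoc u j m))))) ⟩
        (u ^ i * (u ^ m) ^ j) * w ^ j        ≈⟨ trans (*-assoc _ _ _) (*-congˡ (*-comm _ _)) ⟩
        u ^ i * (w ^ j * (u ^ m) ^ j)        ≈⟨ *-congˡ (^-distrib-* w (u ^ m) j) ⟨
        u ^ i * (w * u ^ m) ^ j              ≈⟨ eq ⟩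
        1#                                   ∎) ,
      λ (r∣jm+i , r∣j) → r∤ (∣m+n∣m⇒∣n r∣jm+i (∣m⇒∣m*n m r∣j) , r∣j)

    -- Here `u ^ (r ^ a)` is a nontrivial r-th root of unity, so one of its powers cancels the r-th
    -- root of unity `w ^ (r ^ b)`. As b ≤ a, that power is the `r ^ b`-th power of a power of `u`,
    -- by which `w` is multiplied.
    lower : ∀ {u w a b} → b ℕ.≤ a → ¬ u ^ (r ℕ.^ a) ≈ 1# → u ^ (r ℕ.^ suc a) ≈ 1# → w ^ (r ℕ.^ suc b) ≈ 1# →
            ∃ λ m → (w * u ^ m) ^ (r ℕ.^ b) ≈ 1#
    lower {u} {w} {a} {b} b≤a uᵃ≉1 uᵃ⁺¹≈1 wᵇ⁺¹≈1 = r ℕ.^ (a ℕ.∸ b) ℕ.* proj₁ root , (begin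
      (w * u ^ (r ℕ.^ (a ℕ.∸ b) ℕ.* m)) ^ (r ℕ.^ b)
        ≈⟨ ^-distrib-* w _ (r ℕ.^ b) ⟩
      w ^ (r ℕ.^ b) * (u ^ (r ℕ.^ (a ℕ.∸ b) ℕ.* m)) ^ (r ℕ.^ b)
        ≈⟨ *-congˡ (trans (^-assoc u (r ℕ.^ b) _) (trans (^-congʳ exponent) (sym (^-assoc u m (r ℕ.^ a))))) ⟩
      w ^ (r ℕ.^ b) * (u ^ (r ℕ.^ a)) ^ m
        ≈⟨ proj₂ root ⟩
      1# ∎)
      where
      root = roots-cyclic uᵃ≉1 (trans (^-assoc u r (r ℕ.^ a)) uᵃ⁺¹≈1) (trans (^-assoc w r (r ℕ.^ b)) wᵇ⁺¹≈1)
      m = proj₁ root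
      exponent : r ℕ.^ b ℕ.* (r ℕ.^ (a ℕ.∸ b) ℕ.* m) ≡ m ℕ.* r ℕ.^ a
      exponent = ≡.trans (≡.sym (ℕ.*-assoc (r ℕ.^ b) _ m)) (≡.trans (≡.cong (ℕ._* m)
        (≡.trans (≡.sym (ℕ.^-distribˡ-+-* r b (a ℕ.∸ b))) (≡.cong (r ℕ.^_) (ℕ.m+[n∸m]≡n b≤a)))) (ℕ.*-comm _ m))

    -- Descent on a + b. A bound that is not sharp is decreased outright; if both are sharp, the
    -- element with the smaller exponent is multiplied by a power of the other so that its exponent
    -- drops. At exponent 0 an element is 1 and gives a relation by itself.
    dependent : ∀ a b {u w} → u ^ (r ℕ.^ a) ≈ 1# → w ^ (r ℕ.^ b) ≈ 1# → Dependent u w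
    dependent zero b u≈1 _ = 1 , 0 , trans (*-identityʳ _) u≈1 , λ (r∣1 , _) → prime∤1 r-prime r∣1
    dependent (suc a) zero _ w≈1 = 0 , 1 , trans (*-identityˡ _) w≈1 , λ (_ , r∣1) → prime∤1 r-prime r∣1
    dependent (suc a) (suc b) {u} {w} p s with (u ^ (r ℕ.^ a)) ≟ 1# | (w ^ (r ℕ.^ b)) ≟ 1# | ℕ.≤-total b a
    ... | yes p′ | _      | _        = dependent a (suc b) p′ s
    ... | no _   | yes s′ | _        = dependent (suc a) b p s′
    ... | no u≉1 | no _   | inj₁ b≤a = let m , eq = lower b≤a u≉1 p s in
      dependent-shift m (dependent (suc a) b p eq)
    ... | no _   | no w≉1 | inj₂ a≤b = let m , eq = lower a≤b w≉1 s p in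
      dependent-swap (dependent-shift m (dependent-swap (dependent a (suc b) eq s)))

-- The kernel of a character of order n and the n-th powers.

module KernelsOfCharacters
  {k k₁ k₂} (K : HeytingField k k₁ k₂) (char0 : CharacteristicZero K)
  {c ℓ₁ ℓ₂} (F : HeytingField c ℓ₁ ℓ₂) {q : ℕ}
  (elements : Enumeration (CommutativeRing.setoid (commutativeRing F)) q)
  where

  open FieldNotation K
  open FieldLemmas K
  open FieldPowers K
  open Characters K char0 F elements
  open AbelianGroup characterGroup using () renaming (_≈_ to _≋_)
  open import Algebra.Properties.Monoid.Mult (AbelianGroup.monoid characterGroup) using ()
    renaming (×-assocˡ to power-assoc; ×-congˡ to power-congʳ)
  open ≈-Reasoning setoid

  private
    module M = MultiplicativeCharacter
    module E = Inverse elements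
    module FP = FieldPowers F

  -- Pigeonhole on the q + 1 powers of `x` with exponents 0 to q.
  finite-order : ∀ {x} → ¬ x F.≈ F.0# → ∃ λ n → NonZero n ∧ x F.^ n F.≈ F.1#
  finite-order {x} x≉0 =
    let i , j , i<j , eq = pigeonhole (ℕ.n<1+n q) (λ i → E.from (x F.^ toℕ i))
    in F.powers-collide {x} {toℕ i} {toℕ j} (≉0⇒#0 x≉0) i<j
         (F.trans (F.sym (E.inverseˡ ≡.refl)) (E.inverseˡ eq))

  χ-^ : ∀ χ x n → M.⟦ χ ⟧ (x F.^ n) ≈ M.⟦ χ ⟧ x ^ n
  χ-^ χ x zero    = M.1#-homo χ
  χ-^ χ x (suc n) = trans (M.*-homo χ x (x F.^ n)) (*-congˡ (χ-^ χ x n))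

  -- Units only: at 0 the case n = 0 would compare ε(0) = 0 with 0⁰ = 1.
  power-value : ∀ n χ {x} → ¬ x F.≈ F.0# → M.⟦ power n χ ⟧ x ≈ M.⟦ χ ⟧ x ^ n
  power-value zero    χ x≉0 = ε≉0 x≉0
  power-value (suc n) χ x≉0 = *-congˡ (power-value n χ x≉0)

  order-value : ∀ {n χ x} → HasOrder χ n → ¬ x F.≈ F.0# → M.⟦ χ ⟧ x ^ n ≈ 1#
  order-value {n} {χ} {x} (χⁿ≋ε , _) x≉0 = trans (sym (power-value n χ x≉0)) (trans (χⁿ≋ε x) (ε≉0 x≉0))

  kernel⊆prime-powers : ∀ {r} → Prime r → ¬ r F.× F.1# F.≈ F.0# →
    ∀ χ {g z} → ¬ g F.≈ F.0# → M.⟦ χ ⟧ g # 1# → M.⟦ χ ⟧ g ^ r ≈ 1# →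
    ¬ z F.≈ F.0# → M.⟦ χ ⟧ z ≈ 1# → FP.IsPower r z
  kernel⊆prime-powers {r} r-prime r≉0 χ {g} {z} g≉0 χg#1 χgʳ≈1 z≉0 χz≈1 =
    let a , a≢0 , gᵃ≈1 = finite-order g≉0
        b , b≢0 , zᵇ≈1 = finite-order z≉0
        -- The exponent ab kills both `g` and `z`, so a single `s` prime to `r` serves for both.
        e , s , ab≡ , r∤s = split-prime-power r-prime (a ℕ.* b) {{ℕ.m*n≢0 a b {{a≢0}} {{b≢0}}}}
        reduce : ∀ {x} → x F.^ (a ℕ.* b) F.≈ F.1# → (x F.^ s) F.^ (r ℕ.^ e) F.≈ F.1#
        reduce {x} eq = F.trans (FP.^-assoc x (r ℕ.^ e) s) (F.trans (FP.^-congʳ (≡.sym ab≡)) eq)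
        i , j , gz≈1 , r∤ij = dependent e e
          (reduce (F.trans (FP.^-congʳ (ℕ.*-comm a b)) (FP.^-multiple b gᵃ≈1)))
          (reduce (FP.^-multiple a zᵇ≈1))
    in finish r∤s i j gz≈1 r∤ij
    where
    open FP.PrimeRoots _≟_ (λ _ → ≉0⇒#0) r-prime r≉0 using (dependent)
    instance r≢0 = prime⇒nonZero r-prime
    -- χ(g) has order exactly `r`: an exponent prime to `r` would force χ(g) = 1.
    exponent∣ : ∀ n → M.⟦ χ ⟧ g ^ n ≈ 1# → r ∣ n
    exponent∣ n χgⁿ≈1 with r ∣? n
    ... | yes r∣n = r∣n
    ... | no r∤n  = contradiction χg#1 (#-irrefl (coprime-orders⇒≈1 (prime∤⇒coprime r-prime r∤n) χgⁿ≈1 χgʳ≈1))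
    finish : ∀ {s} → r ∤ s → ∀ i j → (g F.^ s) F.^ i F.* (z F.^ s) F.^ j F.≈ F.1# → ¬ (r ∣ i ∧ r ∣ j) →
             FP.IsPower r z
    finish {s} r∤s i j eq r∤ij = conclude r∣i
      where
      χgⁱˢ≈1 : M.⟦ χ ⟧ g ^ (i ℕ.* s) ≈ 1#
      χgⁱˢ≈1 = begin
        M.⟦ χ ⟧ g ^ (i ℕ.* s)
          ≈⟨ χ-^ χ g (i ℕ.* s) ⟨
        M.⟦ χ ⟧ (g F.^ (i ℕ.* s))
          ≈⟨ M.cong χ (FP.^-assoc g i s) ⟨
        M.⟦ χ ⟧ ((g F.^ s) F.^ i)
          ≈⟨ trans (*-congˡ χz) (*-identityʳ _) ⟨
        M.⟦ χ ⟧ ((g F.^ s) F.^ i) * M.⟦ χ ⟧ ((z F.^ s) F.^ j)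
          ≈⟨ M.*-homo χ _ _ ⟨
        M.⟦ χ ⟧ ((g F.^ s) F.^ i F.* (z F.^ s) F.^ j)
          ≈⟨ trans (M.cong χ eq) (M.1#-homo χ) ⟩
        1# ∎
        where
        χz : M.⟦ χ ⟧ ((z F.^ s) F.^ j) ≈ 1#
        χz = trans (M.cong χ (FP.^-assoc z j s)) (trans (χ-^ χ z (j ℕ.* s))
          (trans (^-cong (j ℕ.* s) χz≈1) (1^n≈1 (j ℕ.* s))))
      r∣i : r ∣ i
      r∣i = [ id , (λ r∣s → contradiction r∣s r∤s) ]′ (euclidsLemma i s r-prime (exponent∣ (i ℕ.* s) χgⁱˢ≈1))
      r∤js : r ∤ j ℕ.* s
      r∤js = [ (λ r∣j → r∤ij (r∣i , r∣j)) , r∤s ]′ ∘ euclidsLemma j s r-prime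
      conclude : r ∣ i → FP.IsPower r z
      -- With i = tr the relation says that z^(js) times an r-th power is 1 = 1ʳ, so z^(js) is an
      -- r-th power; as js is prime to `r`, `z` is one too.
      conclude (divides t ≡.refl) = FP.coprime-power⇒power (prime∤⇒coprime r-prime r∤js) (≉0⇒#0 z≉0)
        (FP.power-quotient r (FP.^#0 t (FP.^#0 s (≉0⇒#0 g≉0)))
          (F.trans (F.*-comm _ _) (F.trans (F.*-cong
              (F.trans (FP.^-swap _ t r) (FP.^-assoc _ t r))
              (F.sym (FP.^-assoc z j s)))
            (F.trans eq (F.sym (FP.1^n≈1 r))))))

  -- Induction on the factors, for a product rn. The character χʳ has order `n` and is 1 at `z`, so
  -- z = wⁿ; then χⁿ has order `r` and χⁿ(w) = χ(z) = 1, so w = vʳ.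
  kernel⊆product-powers : ∀ {ps} → All Prime ps → ¬ ℕ.product ps F.× F.1# F.≈ F.0# →
    ∀ χ → HasOrder χ (ℕ.product ps) → ∀ {z} → ¬ z F.≈ F.0# → M.⟦ χ ⟧ z ≈ 1# → FP.IsPower (ℕ.product ps) z
  kernel⊆product-powers [] _ _ _ {z} _ _ = z , F.*-identityʳ z
  kernel⊆product-powers {r ∷ ps} (r-prime ∷ primes) rn≉0 χ χ-order {z} z≉0 χz≈1 =
    let w , wⁿ≈z = kernel⊆product-powers primes n≉0 (power r χ) χʳ-order z≉0
          (trans (power-value r χ z≉0) (trans (^-cong r χz≈1) (1^n≈1 r)))
        w≉0 : ¬ w F.≈ F.0#
        w≉0 w≈0 = z≉0 (F.trans (F.sym wⁿ≈z) (FP.0^n≈0 n w≈0))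
        g , g≉0 , χⁿg#1 = χⁿ-nontrivial
        v , vʳ≈w = kernel⊆prime-powers r-prime r≉0 (power n χ) g≉0 χⁿg#1
          (trans (^-cong r (power-value n χ g≉0)) (trans (^-assoc _ r n) (order-value {χ = χ} χ-order g≉0)))
          w≉0 (trans (power-value n χ w≉0) (trans (sym (χ-^ χ w n)) (trans (M.cong χ wⁿ≈z) χz≈1)))
    in v , F.trans (FP.^-congʳ (ℕ.*-comm r n)) (F.trans (F.sym (FP.^-assoc v n r)) (F.trans (FP.^-cong n vʳ≈w) wⁿ≈z))
    where
    open import Algebra.Properties.Semiring.Mult F.semiring using (×1-homo-*)
    n = ℕ.product ps
    instance
      n≢0 = productOfPrimes≢0 primes
      r≢0 = prime⇒nonZero r-prime
    r≉0 : ¬ r F.× F.1# F.≈ F.0#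
    r≉0 r≈0 = rn≉0 (F.trans (×1-homo-* r n) (F.trans (F.*-congʳ r≈0) (F.zeroˡ _)))
    n≉0 : ¬ n F.× F.1# F.≈ F.0#
    n≉0 n≈0 = rn≉0 (F.trans (×1-homo-* r n) (F.trans (F.*-congˡ n≈0) (F.zeroʳ _)))
    χʳ-order : HasOrder (power r χ) n
    χʳ-order =
      (λ x → trans (power-assoc χ n r x) (trans (power-congʳ {χ} (ℕ.*-comm n r) x) (proj₁ χ-order x))) ,
      λ l χʳˡ≋ε → ℕ.*-cancelˡ-≤ r (≡.subst (r ℕ.* n ℕ.≤_) (ℕ.*-comm l r)
        (proj₂ χ-order (l ℕ.* r) {{ℕ.m*n≢0 l r}} λ x → trans (sym (power-assoc χ l r x)) (χʳˡ≋ε x)))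
    χⁿ-nontrivial : ∃ λ g → ¬ g F.≈ F.0# ∧ M.⟦ power n χ ⟧ g # 1#
    χⁿ-nontrivial = [ id , (λ χⁿ≋ε → contradiction (proj₂ χ-order n χⁿ≋ε)
      (ℕ.<⇒≱ (≡.subst (n ℕ.<_) (ℕ.*-comm n r) (ℕ.m<m*n n r (ℕ.nonTrivial⇒n>1 r {{prime⇒nonTrivial r-prime}}))))) ]′ (trivial? (power n χ))

  -- Translation by 1 permutes F, so the sum of all elements equals itself plus q times 1.
  q≈0 : q F.× F.1# F.≈ F.0#
  q≈0 = identityˡ-unique _ _ (F.trans (F.+-congʳ (F.sym (F.sum-replicate q {F.1#}))) (F.trans
    (F.sym (F.∑-distrib-+ {q} (λ _ → F.1#) E.to)) (F.sym (F.trans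
      (F.∑-permute E.to (permutation (λ i → E.from (F.1# F.+ E.to i)) (λ i → E.from (F.- F.1# F.+ E.to i))
        (λ i → E.inverseʳ (shifted (F.-‿inverseʳ F.1#) i)) (λ i → E.inverseʳ (shifted (F.-‿inverseˡ F.1#) i))))
      (F.sum-cong {q} {λ i → E.to (E.from (F.1# F.+ E.to i))} {λ i → F.1# F.+ E.to i} λ i → E.inverseˡ ≡.refl)))))
    where
    open import Algebra.Properties.Group F.+-group using (identityˡ-unique)
    shifted : ∀ {u v} → u F.+ v F.≈ F.0# → ∀ i → u F.+ E.to (E.from (v F.+ E.to i)) F.≈ E.to i
    shifted u+v≈0 i = F.trans (F.+-congˡ (E.inverseˡ ≡.refl)) (F.trans (F.sym (F.+-assoc _ _ _))
      (F.trans (F.+-congʳ u+v≈0) (F.+-identityˡ _)))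

  -- If `n` were 0 in F, m times 1 would depend only on m modulo `n`, and q ≡ 1 would give 1 = 0.
  -- Hence the primes dividing `n` are non-zero in F, as the cyclicity of the roots of unity
  -- demands.
  unit-characteristic : ∀ n → .{{_ : NonZero n}} → q % n ≡ 1 % n → ¬ n F.× F.1# F.≈ F.0#
  unit-characteristic n q≡1 n≈0 = 0≉1 (F.trans (F.sym (F.+-identityʳ F.1#)) (F.trans (residue 1)
    (F.trans (×-congˡ (≡.sym q≡1)) (F.trans (F.sym (residue q)) q≈0))))
    where
    open import Algebra.Properties.Monoid.Mult F.+-monoid using (×-congˡ; ×-homo-+)
    open import Algebra.Properties.Semiring.Mult F.semiring using (×1-homo-*)
    residue : ∀ m → m F.× F.1# F.≈ (m % n) F.× F.1#
    residue m = F.trans (×-congˡ (m≡m%n+[m/n]*n m n)) (F.trans (×-homo-+ F.1# (m % n) (m / n ℕ.* n))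
      (F.trans (F.+-congˡ (F.trans (×1-homo-* (m / n) n) (F.trans (F.*-congˡ n≈0) (F.zeroʳ _)))) (F.+-identityʳ _)))

  kernel⊆powers : ∀ n → .{{_ : NonZero n}} → q % n ≡ 1 % n → ∀ χ → HasOrder χ n →
    ∀ {z} → ¬ z F.≈ F.0# → M.⟦ χ ⟧ z ≈ 1# → FP.IsPower n z
  kernel⊆powers n q≡1 χ χ-order z≉0 χz≈1 = go isFactorisation (unit-characteristic n q≡1) χ-order
    where
    open PrimeFactorisation (factorise n)
    -- Generalising over `n` lets the factorisation equation be matched with `refl`.
    go : ∀ {n} → n ≡ ℕ.product factors → ¬ n F.× F.1# F.≈ F.0# → HasOrder χ n → FP.IsPower n _
    go ≡.refl n≉0 χ-order = kernel⊆product-powers factorsPrime n≉0 χ χ-order z≉0 χz≈1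

  -- Lying outside the kernel gives only χ(z) ≠ 1. Apartness follows because χ(z) is an n-th root of
  -- unity, for which being 1 is decidable.
  non-power⇒χ#1 : ∀ n → .{{_ : NonZero n}} → q % n ≡ 1 % n → ∀ χ → HasOrder χ n →
    ∀ {z} → ¬ FP.IsPower n z → M.⟦ χ ⟧ z # 1#
  non-power⇒χ#1 n q≡1 χ χ-order {z} non-power =
    [ id , (λ χz≈1 → contradiction (kernel⊆powers n q≡1 χ χ-order z≉0 χz≈1) non-power) ]′
      (rootOfUnity-dec char0 n (order-value {χ = χ} χ-order z≉0))
    where
    z≉0 : ¬ z F.≈ F.0#
    z≉0 z≈0 = non-power (F.0# , F.trans (FP.0^n≈0 n F.refl) (F.sym z≈0))

-- Sums over the character group under translation by `χₙ`.

module TwistedSums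
  {k k₁ k₂} (K : HeytingField k k₁ k₂) (char0 : CharacteristicZero K)
  {c ℓ₁ ℓ₂} (F : HeytingField c ℓ₁ ℓ₂) {q : ℕ}
  (elements : Enumeration (CommutativeRing.setoid (commutativeRing F)) q)
  where

  open FieldNotation K
  open FieldLemmas K
  open FieldPowers K
  open Characters K char0 F elements
  open KernelsOfCharacters K char0 F elements
  open AbelianGroup characterGroup using () renaming (_≈_ to _≋_; setoid to characterSetoid)
  open import Algebra.Properties.CommutativeMonoid.Sum *-commutativeMonoid using ()
    renaming (sum-cong-≋ to product-cong; ∑-distrib-+ to product-distrib-*)
  open ≈-Reasoning setoid

  private
    module M = MultiplicativeCharacter

  product-distrib-*⁴ : ∀ {n} (a b c d : Fin n → Carrier) →
    product (λ i → (a i * b i) * (c i * d i)) ≈ (product a * product b) * (product c * product d)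
  product-distrib-*⁴ {n} a b c d = trans (product-distrib-* {n} (λ i → a i * b i) (λ i → c i * d i))
    (*-cong (product-distrib-* {n} a b) (product-distrib-* {n} c d))

  product-++ : ∀ m {n} (f : Fin (m ℕ.+ n) → Carrier) →
    product f ≈ product (λ i → f (i ↑ˡ n)) * product (λ i → f (m ↑ʳ i))
  product-++ zero    f = sym (*-identityˡ _)
  product-++ (suc m) f = trans (*-congˡ (product-++ m (f ∘ Fin.suc))) (sym (*-assoc _ _ _))

  -- Separates the twist index `l` from `i`, so that the product can be rotated in `l` alone.
  product-remQuot : ∀ n {m} (f : Fin n ∧ Fin m → Carrier) →
    product (λ j → f (remQuot {n} m j)) ≈ product (λ l → product (λ i → f (l , i)))
  product-remQuot zero        f = refl
  product-remQuot (suc n) {m} f = trans (product-++ m (λ j → f (remQuot {suc n} m j))) (*-cong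
    (product-cong {m} λ i → reflexive (≡.cong f (remQuot-combine {suc n} Fin.zero i)))
    -- `remQuot` unfolds through `splitAt m`: past the first block of `m` indices it recurses with
    -- the quotient raised by one.
    (trans (product-cong {n ℕ.* m} λ j → reflexive (≡.cong (λ s → f (swap ([ (_, Fin.zero) , map₂ Fin.suc ∘ quotRem {n} m ]′ s)))
        (splitAt-↑ʳ m (n ℕ.* m) j)))
      (product-remQuot n (λ (l , i) → f (Fin.suc l , i)))))

  -- Both sides are the product of f 0, ..., f n, with the first or the last factor split off.
  product-slide : ∀ n (f : ℕ → Carrier) →
    f 0 * product {n} (λ l → f (suc (toℕ l))) ≈ product {n} (λ l → f (toℕ l)) * f n
  product-slide zero    f = *-comm _ _
  product-slide (suc n) f = trans (*-congˡ (product-slide n (f ∘ suc))) (sym (*-assoc _ _ _))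

  -- The factor f n is exchanged for f 0 rather than cancelled, so factors may be 0.
  product-rotate : ∀ n (f : ℕ → Carrier) → f n ≈ f 0 →
    product {n} (λ l → f (suc (toℕ l))) ≈ product {n} (λ l → f (toℕ l))
  product-rotate zero    f _     = refl
  product-rotate (suc n) f fn≈f0 = trans (product-slide n (f ∘ suc)) (trans (*-congˡ fn≈f0) (*-comm _ _))

  Respects≋ : (MultiplicativeCharacter → Carrier) → Set _
  Respects≋ φ = ∀ {χ ψ} → χ ≋ ψ → φ χ ≈ φ ψ

  gaussSum-cong : ∀ θ → Respects≋ (gaussSum θ)
  gaussSum-cong θ {χ} {ψ} χ≋ψ = ∑F-cong
    (λ x → M.⟦ χ ⟧ x * AdditiveCharacter.⟦ θ ⟧ x) (λ x → M.⟦ ψ ⟧ x * AdditiveCharacter.⟦ θ ⟧ x) λ x → *-congʳ (χ≋ψ x)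

  -- Multiplying `χ` by `χₙ` raises every twist index by one, and χₙⁿ = ε makes the indices wrap
  -- around. `φ` stands for the Gauss sum of a character or of its inverse.
  twists-shift : ∀ φ → Respects≋ φ → ∀ n χₙ → HasOrder χₙ n → ∀ {m} (A : Fin m → MultiplicativeCharacter) χ →
    product (λ j → φ (twists χₙ n A j ∙ (χ ∙ χₙ))) ≈ product (λ j → φ (twists χₙ n A j ∙ χ))
  twists-shift φ φ-cong n χₙ (χₙⁿ≋ε , _) {m} A χ = begin
    product (λ j → φ (twists χₙ n A j ∙ (χ ∙ χₙ)))
      ≈⟨ product-remQuot n (λ (l , i) → φ ((A i ∙ power (toℕ l) χₙ) ∙ (χ ∙ χₙ))) ⟩
    product {n} (λ l → product {m} (λ i → φ ((A i ∙ power (toℕ l) χₙ) ∙ (χ ∙ χₙ))))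
      ≈⟨ product-cong {n} (λ l → product-cong {m} λ i → φ-cong (absorb (A i) (power (toℕ l) χₙ))) ⟩
    product {n} (λ l → row (suc (toℕ l)))
      ≈⟨ product-rotate n row (product-cong {m} λ i → φ-cong {(A i ∙ power n χₙ) ∙ χ} {(A i ∙ ε) ∙ χ} λ x → *-congʳ (*-congˡ (χₙⁿ≋ε x))) ⟩
    product {n} (λ l → row (toℕ l))
      ≈⟨ product-remQuot n (λ (l , i) → φ ((A i ∙ power (toℕ l) χₙ) ∙ χ)) ⟨
    product (λ j → φ (twists χₙ n A j ∙ χ)) ∎
    where
    row : ℕ → Carrier
    row l = product {m} (λ i → φ ((A i ∙ power l χₙ) ∙ χ))
    absorb : ∀ α ψ → (α ∙ ψ) ∙ (χ ∙ χₙ) ≋ (α ∙ (χₙ ∙ ψ)) ∙ χ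
    absorb α ψ x = trans (*-congˡ (*-comm _ _)) (trans (sym (*-assoc _ _ _))
      (*-congʳ (trans (*-assoc _ _ _) (*-congˡ (*-comm _ _)))))

  -- Translation by `ψ` has translation by `ψ ̅` as its inverse; the enumeration turns both into
  -- maps of indices.
  ∑-translate : ∀ {N} (characters : Enumeration characterSetoid N) (f : MultiplicativeCharacter → Carrier) →
    Respects≋ f → ∀ ψ → ∑[ j < N ] f (Inverse.to characters j) ≈ ∑[ j < N ] f (Inverse.to characters j ∙ ψ)
  ∑-translate {N} characters f f-cong ψ = trans
    (∑-permute {N} (f ∘ C.to) (permutation (λ j → C.from (C.to j ∙ ψ)) (λ j → C.from (C.to j ∙ ψ ̅))
      (λ j → C.inverseʳ (translated {ψ ̅} {ψ} (inverseˡ ψ) j)) (λ j → C.inverseʳ (translated {ψ} {ψ ̅} (inverseʳ ψ) j))))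
    (sum-cong {N} {λ j → f (C.to (C.from (C.to j ∙ ψ)))} {λ j → f (C.to j ∙ ψ)} λ j → f-cong (C.inverseˡ {C.to j ∙ ψ} ≡.refl))
    where
    module C = Inverse characters
    open AbelianGroup characterGroup using (inverseˡ; inverseʳ; identityʳ)
    translated : ∀ {α β} → α ∙ β ≋ ε → ∀ j → C.to (C.from (C.to j ∙ α)) ∙ β ≋ C.to j
    translated {α} {β} αβ≋ε j x = trans (*-congʳ (C.inverseˡ {C.to j ∙ α} ≡.refl x))
      (trans (*-assoc _ _ _) (trans (*-congˡ (αβ≋ε x)) (identityʳ (C.to j) x)))

  -- Translation by `χₙ` gives S = χₙ(z) S for the sum S. The families `u` and `v` are the
  -- reciprocals of the Gauss sums in the denominators, which do not vary with χ.
  twisted-sum-vanishes : ∀ φ ψ → Respects≋ φ → Respects≋ ψ →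
    ∀ n χₙ → HasOrder χₙ n → ∀ {m} (A B : Fin m → MultiplicativeCharacter) (u v : Fin (n ℕ.* m) → Carrier)
    z → M.⟦ χₙ ⟧ z # 1# → ∀ {N} (characters : Enumeration characterSetoid N) →
    ∑[ j < N ]
      (let χ = Inverse.to characters j in
       product (λ i → (φ (twists χₙ n A i ∙ χ) * u i) * (ψ (twists χₙ n B i ∙ χ) * v i)) *
       M.⟦ χ ⟧ (F.- F.1#) ^ (n ℕ.* m) * M.⟦ χ ⟧ z) ≈ 0#
  twisted-sum-vanishes φ ψ φ-cong ψ-cong n χₙ χₙ-order {m} A B u v z χₙz#1 {N} characters = fixed⇒0 χₙz#1 (begin
    M.⟦ χₙ ⟧ z * ∑[ j < N ] term (Inverse.to characters j)
      ≈⟨ *-distribˡ-sum {N} _ (term ∘ Inverse.to characters) ⟩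
    ∑[ j < N ] (M.⟦ χₙ ⟧ z * term (Inverse.to characters j))
      ≈⟨ sum-cong {N} {λ j → term (Inverse.to characters j ∙ χₙ)} (term-shift ∘ Inverse.to characters) ⟨
    ∑[ j < N ] term (Inverse.to characters j ∙ χₙ)
      ≈⟨ ∑-translate characters term (λ {χ} {χ′} → term-cong {χ} {χ′}) χₙ ⟨
    ∑[ j < N ] term (Inverse.to characters j) ∎)
    where
    a b : MultiplicativeCharacter → Fin (n ℕ.* m) → Carrier
    a χ i = φ (twists χₙ n A i ∙ χ)
    b χ i = ψ (twists χₙ n B i ∙ χ)
    factors : MultiplicativeCharacter → Carrier
    factors χ = product (λ i → (a χ i * u i) * (b χ i * v i))
    term : MultiplicativeCharacter → Carrier
    term χ = factors χ * M.⟦ χ ⟧ (F.- F.1#) ^ (n ℕ.* m) * M.⟦ χ ⟧ z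
    term-cong : Respects≋ term
    term-cong χ≋χ′ = *-cong (*-cong
      (product-cong {n ℕ.* m} λ i → *-cong (*-congʳ (φ-cong λ x → *-congˡ (χ≋χ′ x))) (*-congʳ (ψ-cong λ x → *-congˡ (χ≋χ′ x))))
      (^-cong (n ℕ.* m) (χ≋χ′ _))) (χ≋χ′ z)
    factors-shift : ∀ χ → factors (χ ∙ χₙ) ≈ factors χ
    -- Rotation moves the numerators past the fixed `u` and `v`, so the four products are taken
    -- separately.
    factors-shift χ = begin
      factors (χ ∙ χₙ)
        ≈⟨ product-distrib-*⁴ (a (χ ∙ χₙ)) u (b (χ ∙ χₙ)) v ⟩
      (product (a (χ ∙ χₙ)) * product u) * (product (b (χ ∙ χₙ)) * product v)
        ≈⟨ *-cong (*-congʳ (twists-shift φ φ-cong n χₙ χₙ-order A χ)) (*-congʳ (twists-shift ψ ψ-cong n χₙ χₙ-order B χ)) ⟩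
      (product (a χ) * product u) * (product (b χ) * product v)
        ≈⟨ product-distrib-*⁴ (a χ) u (b χ) v ⟨
      factors χ ∎
    sign-trivial : M.⟦ χₙ ⟧ (F.- F.1#) ^ (n ℕ.* m) ≈ 1#
    -- The exponent nm is a multiple of the order of `χₙ`.
    sign-trivial = trans (^-congʳ (ℕ.*-comm n m)) (^-multiple m (order-value {χ = χₙ} χₙ-order -1≉0))
      where
      -1≉0 : ¬ F.- F.1# F.≈ F.0#
      -1≉0 -1≈0 = F.#-irrefl -1≈0 F.-1#0
    term-shift : ∀ χ → term (χ ∙ χₙ) ≈ M.⟦ χₙ ⟧ z * term χ
    term-shift χ = trans (*-congʳ (*-cong (factors-shift χ)
        (trans (^-distrib-* (M.⟦ χ ⟧ (F.- F.1#)) _ (n ℕ.* m)) (trans (*-congˡ sign-trivial) (*-identityʳ _)))))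
      (trans (sym (*-assoc _ _ _)) (*-comm _ _))

-- Specialisation to complex-valued characters.

theorem2p2 : ∀ {c ℓ₁ ℓ₂} (F : HeytingField c ℓ₁ ℓ₂) {q : ℕ}
    (elements : Enumeration (CommutativeRing.setoid (commutativeRing F)) q) →
    let open Characters ℂ-heytingField ℂ-characteristicZero F elements
        open FieldNotation F
    in
    (n : ℕ) → .{{_ : NonZero n}} →
    (p k : ℕ) → Prime p → q ≡ p ℕ.^ suc k → q % n ≡ 1 % n →
    (θ : AdditiveCharacter) (θ-nonTrivial : NonTrivial θ)
    {N : ℕ} (characters : Enumeration (AbelianGroup.setoid characterGroup) N)
    (χₙ : MultiplicativeCharacter) → HasOrder χₙ n →
    {m : ℕ} (A B : Fin m → MultiplicativeCharacter)
    (z : Carrier) → ¬ (∃ λ y → y ^ n ≈ z) →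
    hypergeometric θ θ-nonTrivial characters (twists χₙ n A) (twists χₙ n B) z ≈ᶜ 0ᶜ
-- Over ℂ the type checker would unfold the two sides and compare the proofs that Gauss
-- sums are non-zero. Leaving the real and imaginary parts of the prefactor and of the
-- reciprocal Gauss sums to unification avoids this.
theorem2p2 F elements n _ _ _ _ q≡1 θ θ-nonTrivial characters χₙ χₙ-order A B z non-power =
  *-annihilated (twisted-sum-vanishes (gaussSum θ) (λ χ → gaussSum θ (χ ̅))
    (λ {χ} {ψ} → gaussSum-cong θ {χ} {ψ})
    (λ {χ} {ψ} χ≋ψ → gaussSum-cong θ {χ ̅} {ψ ̅} λ x → χ≋ψ (x ⁻¹))
    n χₙ χₙ-order A B (λ _ → _ +i _) (λ _ → _ +i _)
    z (non-power⇒χ#1 n q≡1 χₙ χₙ-order non-power) characters)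
  where
  open FieldNotation ℂ-heytingField using (trans; *-congˡ; zeroʳ)
  open Characters ℂ-heytingField ℂ-characteristicZero F elements
  open KernelsOfCharacters ℂ-heytingField ℂ-characteristicZero F elements
  open TwistedSums ℂ-heytingField ℂ-characteristicZero F elements
  *-annihilated : ∀ {x y s} → s ≈ᶜ 0ᶜ → (x +i y) *ᶜ s ≈ᶜ 0ᶜ
  *-annihilated {x} {y} s≈0 = trans (*-congˡ {x +i y} s≈0) (zeroʳ (x +i y))
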